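{- Every range-minimizing nine-triangle dissection of the unit square (that is, every dissection $D$ of the unit square into nine nondegenerate triangles with $R(D)=\Delta(9)$) lies outside the single-cap two-rail family.
   Context: A dissection of the unit square into $n$ triangles is a collection of $n$ nondegenerate (positive-area) closed triangles with pairwise disjoint interiors whose union is the square; T-junctions are allowed (a vertex of one triangle may lie in the relative interior of a side of another). If $D$ has triangle areas $a_1,\dots,a_n$, its area range is $R(D)=\max_i a_i-\min_i a_i$, and $\Delta(n)=\inf_D R(D)$ over all dissections of the unit square into $n$ nondegenerate triangles; this infimum is attained for every $n\ge2$. Single-cap two-rail family for nine triangles (up to a symmetry of the square): all nine-triangle dissections consisting of one cap having an entire side of the square as a side and an eight-step two-rail zig-zag in the complementary trapezoid, with arbitrary positive areas and arbitrary direction sequence. Explicitly, let $P=(0,0)$, $Q=(1,0)$, $T=(1,1)$, $S=(0,1)$. The cap is the triangle $STR_c$ with $R_c=(1,1-2c)$, where $c\in(0,1/2)$ is its area. The complementary trapezoid $PQR_cS$ has a lower rail, the segment $PQ$, and an upper rail, the segment $SR_c$. An eight-step two-rail zig-zag with direction sequence $s=(s_1,\dots,s_8)\in\{ -1,+1\}^8$ is a cutting of this trapezoid into eight triangles of the following form: start with $p_0=P$ on the lower rail and $u_0=S$ on the upper rail; at step $i$, if $s_i=-1$ choose $p_i$ on the lower rail strictly beyond $p_{i-1}$ in the direction of $Q$, put $u_i=u_{i-1}$, and the $i$-th triangle is $p_{i-1}p_iu_{i-1}$; if $s_i=+1$ choose $u_i$ on the upper rail strictly beyond $u_{i-1}$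 in the direction of $R_c$, put $p_i=p_{i-1}$, and the $i$-th triangle is $p_{i-1}u_{i-1}u_i$; the zig-zag must end with $p_8=Q$ and $u_8=R_c$. The nine triangles of the dissection are the cap and these eight triangles. -}

module Defs where

open import Algebra.Bundles using (CommutativeRing)
open import Algebra.Core using (Op₁; Op₂)
open import Algebra.Structures using (IsCommutativeRing)
open import Data.Bool.Base using (Bool; if_then_else_)
open import Data.Fin.Base using (Fin; zero; suc; fromℕ; inject₁)
open import Data.Fin.Permutation using (Permutation′; _⟨$⟩ʳ_)
open import Data.Nat.Base using (ℕ; suc)
open import Data.Product.Base using (Σ-syntax; ∃; ∃-syntax; _×_; _,_; proj₁; proj₂)
open import Data.Sum.Base using (inj₁; inj₂)
open import Data.Vec.Functional using (Vector; _∷_; head; tail; foldr)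
open import Level using (Level; _⊔_) renaming (suc to lsuc)
open import Relation.Binary.Bundles using (DecTotalOrder; TotalOrder)
open import Relation.Binary.Core using (Rel)
open import Relation.Binary.PropositionalEquality.Core using (_≢_)
open import Relation.Binary.Structures using (IsDecTotalOrder)
open import Relation.Nullary.Negation.Core using (¬_)
open import Relation.Unary using (Pred; Satisfiable; ⋃; _∈_; _≐_; _⊥_)

import Algebra.Construct.NaturalChoice.Max as Max
import Algebra.Construct.NaturalChoice.Min as Min
import Algebra.Properties.Ring as RingProperties
import Relation.Binary.Construct.NonStrictToStrict as Strict

private
  variable
    a ℓ ℓ₁ ℓ₂ : Level
    m n : ℕ

module _ {A : Set a} (_≤_ : Rel A ℓ₂) where

  IsUpperBound : Pred A ℓ → Pred A (a ⊔ ℓ₂ ⊔ ℓ)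
  IsUpperBound P b = ∀ x → x ∈ P → x ≤ b

  IsLowerBound : Pred A ℓ → Pred A (a ⊔ ℓ₂ ⊔ ℓ)
  IsLowerBound P b = ∀ x → x ∈ P → b ≤ x

  IsSupremum : Pred A ℓ → Pred A (a ⊔ ℓ₂ ⊔ ℓ)
  IsSupremum P s = IsUpperBound P s × (∀ b → IsUpperBound P b → s ≤ b)

  IsInfimum : Pred A ℓ → Pred A (a ⊔ ℓ₂ ⊔ ℓ)
  IsInfimum P s = IsLowerBound P s × (∀ b → IsLowerBound P b → b ≤ s)

-- The classical axioms of the real numbers, which determine them up to
-- isomorphism. Decidability of the order is the classical trichotomy of ℝ.
record CompleteOrderedField c ℓ₁ ℓ₂ : Set (lsuc (c ⊔ ℓ₁ ⊔ ℓ₂)) where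
  infix  4 _≈_ _≤_
  infixl 6 _+_
  infixl 7 _*_
  infix  8 -_
  field
    Carrier           : Set c
    _≈_               : Rel Carrier ℓ₁
    _≤_               : Rel Carrier ℓ₂
    _+_ _*_           : Op₂ Carrier
    -_                : Op₁ Carrier
    0# 1#             : Carrier
    isCommutativeRing : IsCommutativeRing _≈_ _+_ _*_ -_ 0# 1#
    isDecTotalOrder   : IsDecTotalOrder _≈_ _≤_
    0≉1               : ¬ (0# ≈ 1#)
    inverse           : ∀ x → ¬ (x ≈ 0#) → ∃[ y ] x * y ≈ 1#
    +-monoˡ-≤         : ∀ {x y} z → x ≤ y → x + z ≤ y + z
    *-nonNegative     : ∀ {x y} → 0# ≤ x → 0# ≤ y → 0# ≤ x * y
    supremum          : (P : Pred Carrier (c ⊔ ℓ₁ ⊔ ℓ₂)) → Satisfiable P →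
                        ∃ (IsUpperBound _≤_ P) → ∃ (IsSupremum _≤_ P)

  commutativeRing : CommutativeRing c ℓ₁
  commutativeRing = record { isCommutativeRing = isCommutativeRing }

  decTotalOrder : DecTotalOrder c ℓ₁ ℓ₂
  decTotalOrder = record { isDecTotalOrder = isDecTotalOrder }

  totalOrder : TotalOrder c ℓ₁ ℓ₂
  totalOrder = DecTotalOrder.totalOrder decTotalOrder

  open CommutativeRing commutativeRing public
    using (_-_; ring; +-identityˡ; -‿inverseʳ; *-identityˡ)
  open DecTotalOrder decTotalOrder public
    using (module Eq; total; antisym; ≤-respˡ-≈; ≤-respʳ-≈)
    renaming (refl to ≤-refl; trans to ≤-trans; reflexive to ≤-reflexive)
  open Strict _≈_ _≤_ public using (_<_)
  open Max totalOrder public using () renaming (_⊔_ to max)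
  open Min totalOrder public using () renaming (_⊓_ to min)

  0≤1 : 0# ≤ 1#
  0≤1 with total 0# 1#
  ... | inj₁ 0≤1 = 0≤1
  ... | inj₂ 1≤0 = ≤-respʳ-≈ -1*-1≈1 (*-nonNegative 0≤-1 0≤-1)
    where
    open RingProperties ring using (-1*x≈-x; -‿involutive)
    0≤-1 : 0# ≤ - 1#
    0≤-1 = ≤-respˡ-≈ (-‿inverseʳ 1#) (≤-respʳ-≈ (+-identityˡ (- 1#)) (+-monoˡ-≤ (- 1#) 1≤0))
    -1*-1≈1 : - 1# * - 1# ≈ 1#
    -1*-1≈1 = Eq.trans (-1*x≈-x (- 1#)) (-‿involutive 1#)

  2# : Carrier
  2# = 1# + 1#

  2≉0 : ¬ (2# ≈ 0#)
  2≉0 2≈0 = 0≉1 (antisym 0≤1 1≤0)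
    where
    1≤0 : 1# ≤ 0#
    1≤0 = ≤-respʳ-≈ 2≈0 (≤-respˡ-≈ (+-identityˡ 1#) (+-monoˡ-≤ 1# 0≤1))

  ½ : Carrier
  ½ = proj₁ (inverse 2# 2≉0)

  ∣_∣ : Op₁ Carrier
  ∣ x ∣ = max x (- x)

module Geometry {c ℓ₁ ℓ₂} (ℝ : CompleteOrderedField c ℓ₁ ℓ₂) where
  open CompleteOrderedField ℝ

  Point : Set c
  Point = Carrier × Carrier

  Region : Set _
  Region = Pred Point (c ⊔ ℓ₁ ⊔ ℓ₂)

  Interior : Region → Region
  Interior S (x , y) = ∃[ ε ] 0# < ε ×
    (∀ x′ y′ → ∣ x′ - x ∣ < ε → ∣ y′ - y ∣ < ε → (x′ , y′) ∈ S)

  UnitSquare : Pred Point ℓ₂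
  UnitSquare (x , y) = (0# ≤ x × x ≤ 1#) × (0# ≤ y × y ≤ 1#)

  record Triangle : Set c where
    constructor triangle
    field
      v₀ v₁ v₂ : Point

  area : Triangle → Carrier
  area (triangle (x₀ , y₀) (x₁ , y₁) (x₂ , y₂)) =
    ½ * ∣ (x₁ - x₀) * (y₂ - y₀) - (x₂ - x₀) * (y₁ - y₀) ∣

  -- The convex hull of the vertices, in barycentric coordinates.
  closed : Triangle → Region
  closed (triangle (x₀ , y₀) (x₁ , y₁) (x₂ , y₂)) (x , y) =
    ∃[ α ] ∃[ β ] ∃[ γ ]
      0# ≤ α × 0# ≤ β × 0# ≤ γ × α + β + γ ≈ 1# ×
      x ≈ α * x₀ + β * x₁ + γ * x₂ ×
      y ≈ α * y₀ + β * y₁ + γ * y₂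

  record Dissection (n : ℕ) : Set (c ⊔ ℓ₁ ⊔ ℓ₂) where
    field
      triangles     : Vector Triangle n
      nondegenerate : ∀ i → 0# < area (triangles i)
      disjoint      : ∀ {i j} → i ≢ j →
                      Interior (closed (triangles i)) ⊥ Interior (closed (triangles j))
      covers        : ⋃ (Fin n) (λ i → closed (triangles i)) ≐ UnitSquare

    areas : Vector Carrier n
    areas i = area (triangles i)

  open Dissection public using (triangles; areas)

  maximum minimum : Vector Carrier (suc m) → Carrier
  maximum xs = foldr max (head xs) (tail xs)
  minimum xs = foldr min (head xs) (tail xs)

  areaRange : Dissection (suc m) → Carrier
  areaRange D = maximum (areas D) - minimum (areas D)

  -- IsΔ[1+ m ] x says that x is the infimum Δ(m+1). It is a predicate because
  -- naming the infimum as a term would need a proof that dissections exist.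
  IsΔ[1+_] : ℕ → Pred Carrier _
  IsΔ[1+ m ] = IsInfimum _≤_ (λ r → Σ[ D ∈ Dissection (suc m) ] r ≈ areaRange D)

  RangeMinimizing : Pred (Dissection (suc m)) _
  RangeMinimizing {m} D = IsΔ[1+ m ] (areaRange D)

  -- The eight symmetries of the square: each is a reflection in the diagonal
  -- or nothing, followed by any combination of the two reflections
  -- x ↦ 1 - x and y ↦ 1 - y.
  record Symmetry : Set where
    field
      transpose flipX flipY : Bool

    apply : Point → Point
    apply (x , y) =
      let (x′ , y′) = if transpose then (y , x) else (x , y)
      in (if flipX then 1# - x′ else x′) , (if flipY then 1# - y′ else y′)

    applyTriangle : Triangle → Triangle
    applyTriangle (triangle A B C) = triangle (apply A) (apply B) (apply C)

  open Symmetry public using (applyTriangle)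

  P Q T S : Point
  P = 0# , 0#
  Q = 1# , 0#
  T = 1# , 1#
  S = 0# , 1#

  -- κ is the area of the cap STR.
  R : Carrier → Point
  R κ = 1# , 1# - 2# * κ

  along : Point → Point → Carrier → Point
  along (x₀ , y₀) (x₁ , y₁) t = x₀ + t * (x₁ - x₀) , y₀ + t * (y₁ - y₀)

  data Direction : Set where
    lower upper : Direction   -- -1 and +1 respectively

  Step : Direction → (p p′ u u′ : Carrier) → Set (ℓ₁ ⊔ ℓ₂)
  Step lower p p′ u u′ = p < p′ × u′ ≈ u
  Step upper p p′ u u′ = u < u′ × p′ ≈ p

  -- The vertices pᵢ and uᵢ are recorded by their affine parameters along the
  -- rails PQ and SR; both parameters run monotonically from 0 to 1.
  record ZigZag (n : ℕ) (s : Vector Direction n) : Set (c ⊔ ℓ₁ ⊔ ℓ₂) where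
    field
      p u     : Vector Carrier (suc n)
      p-start : p zero ≈ 0#
      u-start : u zero ≈ 0#
      step    : ∀ i → Step (s i) (p (inject₁ i)) (p (suc i)) (u (inject₁ i)) (u (suc i))
      p-end   : p (fromℕ n) ≈ 1#
      u-end   : u (fromℕ n) ≈ 1#

  module _ (κ : Carrier) {s : Vector Direction n} (Z : ZigZag n s) where
    open ZigZag Z

    lowerVertex upperVertex : Vector Point (suc n)
    lowerVertex i = along P Q (p i)
    upperVertex i = along S (R κ) (u i)

    stepTriangle : Direction → Fin n → Triangle
    stepTriangle lower i =
      triangle (lowerVertex (inject₁ i)) (lowerVertex (suc i)) (upperVertex (inject₁ i))
    stepTriangle upper i =
      triangle (lowerVertex (inject₁ i)) (upperVertex (inject₁ i)) (upperVertex (suc i))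

    singleCapTwoRail : Vector Triangle (suc n)
    singleCapTwoRail = triangle S T (R κ) ∷ λ i → stepTriangle (s i) i

  -- Dissections are compared as unordered collections of point sets, so
  -- neither the order of the triangles nor that of their vertices matters.
  SameTriangles : Rel (Vector Triangle n) _
  SameTriangles {n} Δs Δs′ =
    Σ[ π ∈ Permutation′ n ] ∀ i → closed (Δs i) ≐ closed (Δs′ (π ⟨$⟩ʳ i))

  InSingleCapTwoRailFamily : Pred (Dissection (suc n)) _
  InSingleCapTwoRailFamily {n} D =
    Σ[ σ ∈ Symmetry ] Σ[ κ ∈ Carrier ] (0# < κ × κ < ½) ×
    Σ[ s ∈ Vector Direction n ] Σ[ Z ∈ ZigZag n s ]
      SameTriangles (triangles D) (λ i → applyTriangle σ (singleCapTwoRail κ Z i))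

{-# OPTIONS --safe #-}

module Submission where

-- Advancing on either rail of a zig-zag lowers (1 - 2κp)(1 - 2κu) by 4κ times
-- the area cut off, so the nine areas of a family member sum to 1. If its range
-- is at most 8/90000, all its areas lie in [9992/90000, 10008/90000]; interval
-- arithmetic on p and u then shows that none of the 2⁸ direction sequences can
-- end at p = u = 1. But the dissection in Competitor, which lies on a grid, has
-- range below 8/90000.

open import Defs
open import Algebra.Solver.Ring.AlmostCommutativeRing
  using (AlmostCommutativeRing; fromCommutativeRing; _-Raw-AlmostCommutative⟶_)
open import Data.Bool.Base using (true; false; if_then_else_)
open import Data.Fin.Base as Fin using (Fin; zero; suc; inject₁)
open import Data.Fin.Patterns
open import Data.Fin.Permutation using (_⟨$⟩ʳ_; _⟨$⟩ˡ_; inverseʳ)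
open import Data.Integer.Base as ℤ using (ℤ; +_; -[1+_]; +0; +[1+_]; 0ℤ; 1ℤ)
open import Data.List.Base using (List; []; _∷_)
open import Data.List.Relation.Unary.All as All using (All; []; _∷_)
open import Data.List.Relation.Unary.Any as Any using (Any; any?)
open import Data.Maybe.Base as Maybe using (Maybe)
open import Data.Nat.Base as ℕ using (ℕ; zero; suc)
open import Data.Product.Base using (_×_; _,_; proj₁; proj₂; ∃-syntax; uncurry)
open import Data.Sum.Base using (_⊎_; inj₁; inj₂; [_,_]′)
open import Data.Vec.Functional using (Vector; foldr; head; tail)
open import Function.Base using (_∘_)
open import Relation.Binary.PropositionalEquality.Core as ≡ using (_≡_; _≢_)
open import Relation.Binary.PropositionalEquality.Properties using (module ≡-Reasoning)
open import Relation.Nullary.Decidable using (Dec; map′; toWitness; _×-dec_; _⊎-dec_)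
open import Relation.Nullary.Decidable.Core using (dec⇒maybe)
open import Relation.Nullary.Negation.Core using (¬_; contradiction)
open import Relation.Unary using (_∈_; _⊆_; _⊥_)

import Algebra.Bundles
import Algebra.Construct.NaturalChoice.Max as Max
import Algebra.Construct.NaturalChoice.Min as Min
import Algebra.Properties.Ring as RingProperties
import Algebra.Properties.Semiring.Mult.TCOptimised as Mult
import Algebra.Solver.Ring
import Data.Fin.Properties as Fin
import Data.Integer.Properties as ℤ
import Data.Nat.Properties as ℕ
import Relation.Binary.Properties.TotalOrder as TotalOrderProperties

-- The field is abstract and nothing in it computes. Every numerical fact is therefore phrased
-- without division between naturals or integers, decided there by evaluation, and carried over by
-- `fromℤ`, which is a ring homomorphism and monotone. The family has continuous parameters, yet
-- once κ is fixed a step is determined by its direction and its area: with apex t on one rail, the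
-- advance on the other is 2 area / (1 - 2κt). When κ and the areas are confined to a short
-- interval, a box around (p, u) can be pushed through either direction, so a finite tree of boxes
-- accounts for all members of the family. The mean area is 1/9 = 10000/90000, and no area can
-- differ from the mean by more than the range. Membership in the family identifies triangles only
-- as point sets, after a permutation and a symmetry of the square. Area survives this
-- identification, because it is monotone under inclusion and invariant under the symmetries, and
-- nothing but areas is transferred from `D` to the zig-zag.

module OrderedField {c ℓ₁ ℓ₂} (ℝ : CompleteOrderedField c ℓ₁ ℓ₂) where
  open CompleteOrderedField ℝ public
  open Algebra.Bundles.CommutativeRing commutativeRing public
    using (+-cong; +-congˡ; +-congʳ; *-cong; *-congˡ; *-congʳ; -‿cong; +-comm; *-comm; zeroʳ; setoid)
  open Algebra.Bundles.CommutativeRing commutativeRing using (semiring; +-identityʳ)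
  open RingProperties ring
    using (-‿distribˡ-*; -‿distribʳ-*; -‿involutive; -‿anti-homo-+; -0#≈0#)
  private module × = Mult semiring
  open × using () renaming (_×_ to _·_)
  open import Relation.Binary.Reasoning.Setoid setoid

  -- With the optimised multiples, `fromℤ` sends 0, 1 and 2 definitionally to `0#`, `1#` and `2#`,
  -- so solver constants such as `con (+ 2)` match the literals that occur in the geometric
  -- definitions.
  fromℤ : ℤ → Carrier
  fromℤ (+ n)    = n · 1#
  fromℤ -[1+ n ] = - (suc n · 1#)

  fromℤ-⊖ : ∀ m n → fromℤ (m ℤ.⊖ n) ≈ m · 1# - n · 1#
  fromℤ-⊖ m       zero    = Eq.sym (Eq.trans (+-congˡ -0#≈0#) (+-identityʳ _))
  fromℤ-⊖ zero    (suc n) = Eq.sym (+-identityˡ _)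
  fromℤ-⊖ (suc m) (suc n) = begin
    fromℤ (suc m ℤ.⊖ suc n)               ≡⟨ ≡.cong fromℤ (ℤ.[1+m]⊖[1+n]≡m⊖n m n) ⟩
    fromℤ (m ℤ.⊖ n)                       ≈⟨ fromℤ-⊖ m n ⟩
    m · 1# - n · 1#                       ≈⟨ cancel ⟩
    (1# + m · 1#) - (1# + n · 1#)         ≈⟨ +-cong (×.1+× m 1#) (-‿cong (×.1+× n 1#)) ⟨
    suc m · 1# - suc n · 1#               ∎
    where
    open Algebra.Bundles.CommutativeRing commutativeRing using (+-assoc)
    cancel : m · 1# - n · 1# ≈ (1# + m · 1#) - (1# + n · 1#)
    cancel = Eq.sym (begin
      (1# + m · 1#) - (1# + n · 1#)       ≈⟨ +-congˡ (-‿anti-homo-+ 1# _) ⟩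
      (1# + m · 1#) + (- (n · 1#) - 1#)   ≈⟨ +-congʳ (+-comm 1# _) ⟩
      (m · 1# + 1#) + (- (n · 1#) - 1#)   ≈⟨ +-congˡ (+-comm _ (- 1#)) ⟩
      (m · 1# + 1#) + (- 1# - n · 1#)     ≈⟨ +-assoc _ 1# _ ⟩
      m · 1# + (1# + (- 1# - n · 1#))     ≈⟨ +-congˡ (+-assoc 1# (- 1#) _) ⟨
      m · 1# + ((1# - 1#) - n · 1#)       ≈⟨ +-congˡ (+-congʳ (-‿inverseʳ 1#)) ⟩
      m · 1# + (0# - n · 1#)              ≈⟨ +-congˡ (+-identityˡ _) ⟩
      m · 1# - n · 1#                     ∎)

  fromℤ-neg : ∀ i → fromℤ (ℤ.- i) ≈ - fromℤ i
  fromℤ-neg +0       = Eq.sym -0#≈0#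
  fromℤ-neg +[1+ n ] = Eq.refl
  fromℤ-neg -[1+ n ] = Eq.sym (-‿involutive _)

  fromℤ-+ : ∀ i j → fromℤ (i ℤ.+ j) ≈ fromℤ i + fromℤ j
  fromℤ-+ (+ m)    (+ n)    = ×.×-homo-+ 1# m n
  fromℤ-+ (+ m)    -[1+ n ] = fromℤ-⊖ m (suc n)
  fromℤ-+ -[1+ m ] (+ n)    = Eq.trans (fromℤ-⊖ n (suc m)) (+-comm _ _)
  fromℤ-+ -[1+ m ] -[1+ n ] = begin
    - (suc (suc (m ℕ.+ n)) · 1#)          ≡⟨ ≡.cong (λ k → - (k · 1#)) (≡.cong suc (ℕ.+-comm (suc m) n)) ⟩
    - ((suc n ℕ.+ suc m) · 1#)            ≈⟨ -‿cong (×.×-homo-+ 1# (suc n) (suc m)) ⟩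
    - (suc n · 1# + suc m · 1#)           ≈⟨ -‿anti-homo-+ _ _ ⟩
    - (suc m · 1#) - suc n · 1#           ∎

  fromℤ-*ˡ : ∀ m j → fromℤ (+ m ℤ.* j) ≈ fromℤ (+ m) * fromℤ j
  fromℤ-*ˡ m (+ n) = begin
    fromℤ (+ m ℤ.* + n)                   ≡⟨ ≡.cong fromℤ (ℤ.pos-* m n) ⟨
    (m ℕ.* n) · 1#                        ≈⟨ ×.×1-homo-* m n ⟩
    m · 1# * n · 1#                       ∎
  fromℤ-*ˡ m -[1+ n ] = begin
    fromℤ (+ m ℤ.* -[1+ n ])              ≡⟨ ≡.cong fromℤ (ℤ.neg-distribʳ-* (+ m) (+ suc n)) ⟨
    fromℤ (ℤ.- (+ m ℤ.* + suc n))         ≈⟨ fromℤ-neg (+ m ℤ.* + suc n) ⟩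
    - fromℤ (+ m ℤ.* + suc n)             ≈⟨ -‿cong (fromℤ-*ˡ m (+ suc n)) ⟩
    - (m · 1# * suc n · 1#)               ≈⟨ -‿distribʳ-* _ _ ⟩
    m · 1# * - (suc n · 1#)               ∎

  fromℤ-* : ∀ i j → fromℤ (i ℤ.* j) ≈ fromℤ i * fromℤ j
  fromℤ-* (+ m)    j = fromℤ-*ˡ m j
  fromℤ-* -[1+ m ] j = begin
    fromℤ (-[1+ m ] ℤ.* j)                ≡⟨ ≡.cong fromℤ (ℤ.neg-distribˡ-* (+ suc m) j) ⟨
    fromℤ (ℤ.- (+ suc m ℤ.* j))           ≈⟨ fromℤ-neg (+ suc m ℤ.* j) ⟩
    - fromℤ (+ suc m ℤ.* j)               ≈⟨ -‿cong (fromℤ-*ˡ (suc m) j) ⟩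
    - (suc m · 1# * fromℤ j)              ≈⟨ -‿distribˡ-* _ _ ⟩
    - (suc m · 1#) * fromℤ j              ∎

  private
    almostCommutativeRing : AlmostCommutativeRing c ℓ₁
    almostCommutativeRing = fromCommutativeRing commutativeRing

    morphism : ℤ.+-*-rawRing -Raw-AlmostCommutative⟶ almostCommutativeRing
    morphism = record
      { ⟦_⟧    = fromℤ
      ; +-homo = fromℤ-+
      ; *-homo = fromℤ-*
      ; -‿homo = fromℤ-neg
      ; 0-homo = Eq.refl
      ; 1-homo = Eq.refl
      }

    coefficient≟ : ∀ i j → Maybe (fromℤ i ≈ fromℤ j)
    coefficient≟ i j = Maybe.map (λ i≡j → Eq.reflexive (≡.cong fromℤ i≡j)) (dec⇒maybe (i ℤ.≟ j))

  module Solver = Algebra.Solver.Ring ℤ.+-*-rawRing almostCommutativeRing morphism coefficient≟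
  open Solver


  -- Order, inverses and absolute value in the field.

  open TotalOrderProperties totalOrder public using (≰⇒>; <⇒≱; <-respʳ-≈)
  module MaxProperties = Max totalOrder
  module MinProperties = Min totalOrder

  private
    variable
      w x y z e : Carrier

  x≤y⇒0≤y-x : x ≤ y → 0# ≤ y - x
  x≤y⇒0≤y-x {x} x≤y = ≤-respˡ-≈ (-‿inverseʳ x) (+-monoˡ-≤ (- x) x≤y)

  -- Inequalities are proved by exhibiting the difference as a visibly
  -- non-negative expression.
  ≤-by : y - x ≈ e → 0# ≤ e → x ≤ y
  ≤-by {y} {x} y-x≈e 0≤e =
    ≤-respʳ-≈ (solve 2 (λ x y → (y :- x) :+ x := y) Eq.refl x y)
      (≤-respˡ-≈ (+-identityˡ x) (+-monoˡ-≤ x (≤-respʳ-≈ (Eq.sym y-x≈e) 0≤e)))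

  +-nonNegative : 0# ≤ x → 0# ≤ y → 0# ≤ x + y
  +-nonNegative {x} {y} 0≤x 0≤y =
    ≤-trans 0≤y (≤-respˡ-≈ (+-identityˡ y) (+-monoˡ-≤ y 0≤x))

  +-mono-≤ : w ≤ x → y ≤ z → w + y ≤ x + z
  +-mono-≤ {w} {x} {y} {z} w≤x y≤z = ≤-by
    (solve 4 (λ w x y z → (x :+ z) :- (w :+ y) := (x :- w) :+ (z :- y)) Eq.refl w x y z)
    (+-nonNegative (x≤y⇒0≤y-x w≤x) (x≤y⇒0≤y-x y≤z))

  -‿antimono-≤ : x ≤ y → - y ≤ - x
  -‿antimono-≤ {x} {y} x≤y = ≤-by
    (solve 2 (λ x y → :- x :- :- y := y :- x) Eq.refl x y) (x≤y⇒0≤y-x x≤y)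

  *-monoʳ-≤ : 0# ≤ x → y ≤ z → x * y ≤ x * z
  *-monoʳ-≤ {x} {y} {z} 0≤x y≤z = ≤-by
    (solve 3 (λ x y z → x :* z :- x :* y := x :* (z :- y)) Eq.refl x y z)
    (*-nonNegative 0≤x (x≤y⇒0≤y-x y≤z))

  *-mono-≤ : 0# ≤ w → 0# ≤ z → w ≤ x → y ≤ z → w * y ≤ x * z
  *-mono-≤ {w} {z} {x} {y} 0≤w 0≤z w≤x y≤z = ≤-by
    (solve 4 (λ w x y z → x :* z :- w :* y := (x :- w) :* z :+ w :* (z :- y)) Eq.refl w x y z)
    (+-nonNegative (*-nonNegative (x≤y⇒0≤y-x w≤x) 0≤z) (*-nonNegative 0≤w (x≤y⇒0≤y-x y≤z)))

  >0⇒≉0 : 0# < x → ¬ x ≈ 0#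
  >0⇒≉0 (_ , 0≉x) x≈0 = 0≉x (Eq.sym x≈0)

  0<1 : 0# < 1#
  0<1 = 0≤1 , 0≉1

  _⁻¹⟨_⟩ : ∀ x → 0# < x → Carrier
  x ⁻¹⟨ 0<x ⟩ = proj₁ (inverse x (>0⇒≉0 0<x))

  ⁻¹-inverse : ∀ x (0<x : 0# < x) → x * x ⁻¹⟨ 0<x ⟩ ≈ 1#
  ⁻¹-inverse x 0<x = proj₂ (inverse x (>0⇒≉0 0<x))

  ⁻¹-nonNegative : 0# < x → x * y ≈ 1# → 0# ≤ y
  ⁻¹-nonNegative {x} {y} 0<x xy≈1 = [ (λ 0≤y → 0≤y) , (λ y≤0 → contradiction (1≤0 y≤0) (<⇒≱ 0<1)) ]′ (total 0# y)
    where
    1≤0 : y ≤ 0# → 1# ≤ 0#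
    1≤0 y≤0 = ≤-by
      (begin
        0# - 1#        ≈⟨ +-congˡ (-‿cong xy≈1) ⟨
        0# - x * y     ≈⟨ solve 2 (λ x y → con 0ℤ :- x :* y := x :* (con 0ℤ :- y)) Eq.refl x y ⟩
        x * (0# - y)   ∎)
      (*-nonNegative (proj₁ 0<x) (x≤y⇒0≤y-x y≤0))

  ⁻¹-positive : 0# < x → x * y ≈ 1# → 0# < y
  ⁻¹-positive {x} {y} 0<x xy≈1 = ⁻¹-nonNegative 0<x xy≈1 ,
    λ 0≈y → 0≉1 (Eq.trans (Eq.sym (zeroʳ x)) (Eq.trans (*-congˡ 0≈y) xy≈1))

  module _ (0<x : 0# < x) where

    private
      x⁻¹*[x*y]≈y : ∀ y → x ⁻¹⟨ 0<x ⟩ * (x * y) ≈ y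
      x⁻¹*[x*y]≈y y = begin
        x ⁻¹⟨ 0<x ⟩ * (x * y)   ≈⟨ solve 3 (λ x i y → i :* (x :* y) := (x :* i) :* y) Eq.refl x _ y ⟩
        (x * x ⁻¹⟨ 0<x ⟩) * y   ≈⟨ *-congʳ (⁻¹-inverse x 0<x) ⟩
        1# * y                  ≈⟨ *-identityˡ y ⟩
        y                       ∎

    *-cancelˡ-0≤ : 0# ≤ x * y → 0# ≤ y
    *-cancelˡ-0≤ {y} 0≤xy = ≤-respʳ-≈ (x⁻¹*[x*y]≈y y)
      (*-nonNegative (⁻¹-nonNegative 0<x (⁻¹-inverse x 0<x)) 0≤xy)

    *-cancelˡ-≤ : x * y ≤ x * z → y ≤ z
    *-cancelˡ-≤ {y} {z} xy≤xz = ≤-by Eq.refl (*-cancelˡ-0≤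
      (≤-respʳ-≈ (solve 3 (λ x y z → x :* z :- x :* y := x :* (z :- y)) Eq.refl x y z) (x≤y⇒0≤y-x xy≤xz)))

    *-positive : 0# < y → 0# < x * y
    *-positive {y} (0≤y , 0≉y) = *-nonNegative (proj₁ 0<x) 0≤y ,
      λ 0≈xy → 0≉y (begin
        0#                      ≈⟨ zeroʳ _ ⟨
        x ⁻¹⟨ 0<x ⟩ * 0#        ≈⟨ *-congˡ 0≈xy ⟩
        x ⁻¹⟨ 0<x ⟩ * (x * y)   ≈⟨ x⁻¹*[x*y]≈y y ⟩
        y                       ∎)

  +-nonNegative-positive : 0# ≤ x → 0# < y → 0# < x + y
  +-nonNegative-positive {x} {y} 0≤x 0<y = ≰⇒> λ x+y≤0 → <⇒≱ 0<y (≤-trans y≤x+y x+y≤0)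
    where
    y≤x+y : y ≤ x + y
    y≤x+y = ≤-by (solve 2 (λ x y → x :+ y :- y := x) Eq.refl x y) 0≤x

  x<y⇒0<y-x : x < y → 0# < y - x
  x<y⇒0<y-x {x} {y} x<y = ≰⇒> λ y-x≤0 → <⇒≱ x<y (≤-by
    (solve 2 (λ x y → x :- y := con 0ℤ :- (y :- x)) Eq.refl x y) (x≤y⇒0≤y-x y-x≤0))

  0<2 : 0# < 2#
  0<2 = +-nonNegative-positive 0≤1 0<1

  2*½ : 2# * ½ ≈ 1#
  2*½ = proj₂ (inverse 2# 2≉0)

  0<½ : 0# < ½
  0<½ = ⁻¹-positive 0<2 2*½

  fromℤ-nonNegative : ∀ n → 0# ≤ n · 1#
  fromℤ-nonNegative zero    = ≤-refl
  fromℤ-nonNegative (suc n) = ≤-respʳ-≈ (Eq.sym (×.1+× n 1#)) (+-nonNegative 0≤1 (fromℤ-nonNegative n))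

  fromℤ-sub : ∀ i j → fromℤ (i ℤ.- j) ≈ fromℤ i - fromℤ j
  fromℤ-sub i j = Eq.trans (fromℤ-+ i (ℤ.- j)) (+-congˡ (fromℤ-neg j))

  fromℤ-mono-≤ : ∀ {i j} → i ℤ.≤ j → fromℤ i ≤ fromℤ j
  fromℤ-mono-≤ {i} {j} i≤j = ≤-by (Eq.sym (fromℤ-sub j i)) (0≤fromℤ (ℤ.i≤j⇒0≤j-i i≤j))
    where
    0≤fromℤ : ∀ {i} → 0ℤ ℤ.≤ i → 0# ≤ fromℤ i
    0≤fromℤ {+ n} _ = fromℤ-nonNegative n

  -- Over the integers i < j means 1 + i ≤ j, so j ≤ i in the field would give 1 ≤ 0.
  fromℤ-mono-< : ∀ {i j} → i ℤ.< j → fromℤ i < fromℤ j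
  fromℤ-mono-< {i} {j} i<j = ≰⇒> λ j≤i → <⇒≱ 0<1 (≤-by
    (begin
      0# - 1#                       ≈⟨ solve 1 (λ i → con 0ℤ :- con 1ℤ := i :- (con 1ℤ :+ i)) Eq.refl (fromℤ i) ⟩
      fromℤ i - (1# + fromℤ i)      ≈⟨ +-congˡ (-‿cong (fromℤ-+ 1ℤ i)) ⟨
      fromℤ i - fromℤ (1ℤ ℤ.+ i)    ∎)
    (x≤y⇒0≤y-x (≤-trans (fromℤ-mono-≤ (ℤ.i<j⇒suc[i]≤j i<j)) j≤i)))

  fromℤ-positive : ∀ {i} → 0ℤ ℤ.< i → 0# < fromℤ i
  fromℤ-positive = fromℤ-mono-<

  x≤∣x∣ : ∀ x → x ≤ ∣ x ∣
  x≤∣x∣ x = MaxProperties.x≤x⊔y x (- x)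

  -x≤∣x∣ : ∀ x → - x ≤ ∣ x ∣
  -x≤∣x∣ x = MaxProperties.x≤y⊔x x (- x)

  ∣∣-lub : x ≤ y → - x ≤ y → ∣ x ∣ ≤ y
  ∣∣-lub = MaxProperties.⊔-lub

  ∣∣-cong : x ≈ y → ∣ x ∣ ≈ ∣ y ∣
  ∣∣-cong x≈y = MaxProperties.⊔-cong x≈y (-‿cong x≈y)

  ∣-x∣≈∣x∣ : ∀ x → ∣ - x ∣ ≈ ∣ x ∣
  ∣-x∣≈∣x∣ x = antisym
    (∣∣-lub (-x≤∣x∣ x) (≤-respˡ-≈ (Eq.sym (-‿involutive x)) (x≤∣x∣ x)))
    (∣∣-lub (≤-respˡ-≈ (-‿involutive x) (-x≤∣x∣ (- x))) (x≤∣x∣ (- x)))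

  0≤x⇒∣x∣≈x : 0# ≤ x → ∣ x ∣ ≈ x
  0≤x⇒∣x∣≈x {x} 0≤x = antisym
    (∣∣-lub ≤-refl (≤-trans -x≤0 0≤x)) (x≤∣x∣ x)
    where
    -x≤0 : - x ≤ 0#
    -x≤0 = ≤-by (solve 1 (λ x → con 0ℤ :- :- x := x) Eq.refl x) 0≤x

  fromℕ : ℕ → Carrier
  fromℕ n = fromℤ (+ n)

  fromℕ-+ : ∀ m n → fromℕ (m ℕ.+ n) ≈ fromℕ m + fromℕ n
  fromℕ-+ = ×.×-homo-+ 1#

  fromℕ-* : ∀ m n → fromℕ (m ℕ.* n) ≈ fromℕ m * fromℕ n
  fromℕ-* = ×.×1-homo-*

  fromℕ-mono-≤ : ∀ {m n} → m ℕ.≤ n → fromℕ m ≤ fromℕ n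
  fromℕ-mono-≤ m≤n = fromℤ-mono-≤ (ℤ.+≤+ m≤n)

  fromℕ-mono-< : ∀ {m n} → m ℕ.< n → fromℕ m < fromℕ n
  fromℕ-mono-< m<n = fromℤ-mono-< (ℤ.+<+ m<n)

  fromℕ-nonNegative : ∀ n → 0# ≤ fromℕ n
  fromℕ-nonNegative = fromℤ-nonNegative

-- Area as a function of the point set, and its invariance under symmetries.

module Area {c ℓ₁ ℓ₂} (ℝ : CompleteOrderedField c ℓ₁ ℓ₂) where
  open OrderedField ℝ
  open Solver
  open Geometry ℝ
  open import Relation.Binary.Reasoning.Setoid setoid

  det : Point → Point → Point → Carrier
  det (x₀ , y₀) (x₁ , y₁) (x₂ , y₂) = (x₁ - x₀) * (y₂ - y₀) - (x₂ - x₀) * (y₁ - y₀)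

  det-cyclic : ∀ p q r → det p q r ≈ det q r p
  det-cyclic (x₀ , y₀) (x₁ , y₁) (x₂ , y₂) = solve 6 (λ x₀ y₀ x₁ y₁ x₂ y₂ →
    (x₁ :- x₀) :* (y₂ :- y₀) :- (x₂ :- x₀) :* (y₁ :- y₀) :=
    (x₂ :- x₁) :* (y₀ :- y₁) :- (x₀ :- x₁) :* (y₂ :- y₁)) Eq.refl x₀ y₀ x₁ y₁ x₂ y₂

  det-anti : ∀ p q r → det q p r ≈ - det p q r
  det-anti (x₀ , y₀) (x₁ , y₁) (x₂ , y₂) = solve 6 (λ x₀ y₀ x₁ y₁ x₂ y₂ →
    (x₀ :- x₁) :* (y₂ :- y₁) :- (x₂ :- x₁) :* (y₀ :- y₁) :=
    :- ((x₁ :- x₀) :* (y₂ :- y₀) :- (x₂ :- x₀) :* (y₁ :- y₀))) Eq.refl x₀ y₀ x₁ y₁ x₂ y₂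

  det-degenerate : ∀ p q → det p p q ≈ 0#
  det-degenerate (x₀ , y₀) (x₁ , y₁) = solve 4 (λ x₀ y₀ x₁ y₁ →
    (x₀ :- x₀) :* (y₁ :- y₀) :- (x₁ :- x₀) :* (y₀ :- y₀) := con 0ℤ) Eq.refl x₀ y₀ x₁ y₁

  affine : (u v k : Carrier) → Point → Carrier
  affine u v k (x , y) = u * x + v * y + k

  det≈affine : (p q r : Point) → let (x₀ , y₀) = p ; (x₁ , y₁) = q in
    det p q r ≈ affine (y₀ - y₁) (x₁ - x₀) (x₀ * y₁ - x₁ * y₀) r
  det≈affine (x₀ , y₀) (x₁ , y₁) (x₂ , y₂) = solve 6 (λ x₀ y₀ x₁ y₁ x₂ y₂ →
    (x₁ :- x₀) :* (y₂ :- y₀) :- (x₂ :- x₀) :* (y₁ :- y₀) :=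
    (y₀ :- y₁) :* x₂ :+ (x₁ :- x₀) :* y₂ :+ (x₀ :* y₁ :- x₁ :* y₀)) Eq.refl x₀ y₀ x₁ y₁ x₂ y₂

  vertex : Triangle → Fin 3 → Point
  vertex T 0F = Triangle.v₀ T
  vertex T 1F = Triangle.v₁ T
  vertex T 2F = Triangle.v₂ T

  -- An affine function commutes with convex combinations; the weights summing to 1 take care of the
  -- constant term.
  closed-affine-0≤ : ∀ T u v k → (∀ i → 0# ≤ affine u v k (vertex T i)) →
    ∀ {p} → p ∈ closed T → 0# ≤ affine u v k p
  closed-affine-0≤ (triangle (x₀ , y₀) (x₁ , y₁) (x₂ , y₂)) u v k 0≤ {x , y}
    (α , β , γ , 0≤α , 0≤β , 0≤γ , α+β+γ≈1 , x≈ , y≈) =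
    ≤-respʳ-≈ (Eq.sym (begin
      u * x + v * y + k
        ≈⟨ +-cong (+-cong (*-congˡ x≈) (*-congˡ y≈)) (Eq.trans (Eq.sym (*-identityˡ k)) (*-congʳ (Eq.sym α+β+γ≈1))) ⟩
      u * (α * x₀ + β * x₁ + γ * x₂) + v * (α * y₀ + β * y₁ + γ * y₂) + (α + β + γ) * k
        ≈⟨ solve 12 (λ u v k α β γ x₀ y₀ x₁ y₁ x₂ y₂ →
             u :* (α :* x₀ :+ β :* x₁ :+ γ :* x₂) :+ v :* (α :* y₀ :+ β :* y₁ :+ γ :* y₂) :+ (α :+ β :+ γ) :* k :=
             α :* (u :* x₀ :+ v :* y₀ :+ k) :+ β :* (u :* x₁ :+ v :* y₁ :+ k) :+ γ :* (u :* x₂ :+ v :* y₂ :+ k))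
             Eq.refl u v k α β γ x₀ y₀ x₁ y₁ x₂ y₂ ⟩
      α * affine u v k (x₀ , y₀) + β * affine u v k (x₁ , y₁) + γ * affine u v k (x₂ , y₂) ∎))
    (+-nonNegative (+-nonNegative
      (*-nonNegative 0≤α (0≤ 0F)) (*-nonNegative 0≤β (0≤ 1F))) (*-nonNegative 0≤γ (0≤ 2F)))

  closed-det-≤ : ∀ T p q {m} → (∀ i → det p q (vertex T i) ≤ m) →
    ∀ {r} → r ∈ closed T → det p q r ≤ m
  closed-det-≤ T p q {m} ≤m {r} r∈T = ≤-by (m-det≈affine r)
    (closed-affine-0≤ T _ _ _ (λ i → ≤-respʳ-≈ (m-det≈affine (vertex T i)) (x≤y⇒0≤y-x (≤m i))) r∈T)
    where
    m-det≈affine : ∀ r → let (x₀ , y₀) = p ; (x₁ , y₁) = q in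
      m - det p q r ≈ affine (- (y₀ - y₁)) (- (x₁ - x₀)) (m - (x₀ * y₁ - x₁ * y₀)) r
    m-det≈affine r@(x , y) = Eq.trans (+-congˡ (-‿cong (det≈affine p q r)))
      (solve 6 (λ u v k m x y → m :- (u :* x :+ v :* y :+ k) := :- u :* x :+ :- v :* y :+ (m :- k))
        Eq.refl _ _ _ m x y)

  vertex∈closed : ∀ T i → vertex T i ∈ closed T
  vertex∈closed (triangle (x₀ , y₀) (x₁ , y₁) (x₂ , y₂)) 0F =
    1# , 0# , 0# , 0≤1 , ≤-refl , ≤-refl ,
    solve 0 (con 1ℤ :+ con 0ℤ :+ con 0ℤ := con 1ℤ) Eq.refl , eq x₀ x₁ x₂ , eq y₀ y₁ y₂
    where eq = solve 3 (λ a b c → a := con 1ℤ :* a :+ con 0ℤ :* b :+ con 0ℤ :* c) Eq.refl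
  vertex∈closed (triangle (x₀ , y₀) (x₁ , y₁) (x₂ , y₂)) 1F =
    0# , 1# , 0# , ≤-refl , 0≤1 , ≤-refl ,
    solve 0 (con 0ℤ :+ con 1ℤ :+ con 0ℤ := con 1ℤ) Eq.refl , eq x₀ x₁ x₂ , eq y₀ y₁ y₂
    where eq = solve 3 (λ a b c → b := con 0ℤ :* a :+ con 1ℤ :* b :+ con 0ℤ :* c) Eq.refl
  vertex∈closed (triangle (x₀ , y₀) (x₁ , y₁) (x₂ , y₂)) 2F =
    0# , 0# , 1# , ≤-refl , ≤-refl , 0≤1 ,
    solve 0 (con 0ℤ :+ con 0ℤ :+ con 1ℤ := con 1ℤ) Eq.refl , eq x₀ x₁ x₂ , eq y₀ y₁ y₂
    where eq = solve 3 (λ a b c → c := con 0ℤ :* a :+ con 0ℤ :* b :+ con 1ℤ :* c) Eq.refl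

  triangleDet : Triangle → Carrier
  triangleDet (triangle p q r) = det p q r

  -- Of the 27 triples of vertices, the even permutations give the determinant d, the odd ones -d,
  -- and those with a repetition 0.
  vertices-det-≤ : ∀ T i j k → det (vertex T i) (vertex T j) (vertex T k) ≤ ∣ triangleDet T ∣
  vertices-det-≤ T@(triangle p q r) = cases
    where
    d : Carrier
    d = triangleDet T

    even : ∀ {x} → x ≈ d → x ≤ ∣ d ∣
    even x≈d = ≤-respˡ-≈ (Eq.sym x≈d) (x≤∣x∣ d)

    odd : ∀ {x} → x ≈ - d → x ≤ ∣ d ∣
    odd x≈-d = ≤-respˡ-≈ (Eq.sym x≈-d) (-x≤∣x∣ d)

    0≤∣d∣ : 0# ≤ ∣ d ∣
    0≤∣d∣ = *-cancelˡ-0≤ 0<2 (≤-respʳ-≈ (solve 1 (λ m → m :+ m := con (+ 2) :* m) Eq.refl ∣ d ∣)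
      (≤-respˡ-≈ (-‿inverseʳ d) (+-mono-≤ (x≤∣x∣ d) (-x≤∣x∣ d))))

    repeat₁₂ : ∀ a b → det a a b ≤ ∣ d ∣
    repeat₁₂ a b = ≤-respˡ-≈ (Eq.sym (det-degenerate a b)) 0≤∣d∣

    repeat₁₃ : ∀ a b → det a b a ≤ ∣ d ∣
    repeat₁₃ a b = ≤-respˡ-≈ (det-cyclic a a b) (repeat₁₂ a b)

    repeat₂₃ : ∀ a b → det a b b ≤ ∣ d ∣
    repeat₂₃ a b = ≤-respˡ-≈ (Eq.sym (det-cyclic a b b)) (repeat₁₂ b a)

    cases : ∀ i j k → det (vertex T i) (vertex T j) (vertex T k) ≤ ∣ d ∣
    cases 0F 1F 2F = even Eq.refl
    cases 1F 2F 0F = even (Eq.sym (det-cyclic p q r))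
    cases 2F 0F 1F = even (det-cyclic r p q)
    cases 1F 0F 2F = odd (det-anti p q r)
    cases 0F 2F 1F = odd (Eq.trans (Eq.sym (det-cyclic q p r)) (det-anti p q r)) 
    cases 2F 1F 0F = odd (Eq.trans (det-cyclic r q p) (det-anti p q r))
    cases 0F 0F k  = repeat₁₂ p (vertex T k)
    cases 1F 1F k  = repeat₁₂ q (vertex T k)
    cases 2F 2F k  = repeat₁₂ r (vertex T k)
    cases 0F 1F 0F = repeat₁₃ p q
    cases 0F 2F 0F = repeat₁₃ p r
    cases 1F 0F 1F = repeat₁₃ q p
    cases 1F 2F 1F = repeat₁₃ q r
    cases 2F 0F 2F = repeat₁₃ r p
    cases 2F 1F 2F = repeat₁₃ r q
    cases 0F 1F 1F = repeat₂₃ p q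
    cases 0F 2F 2F = repeat₂₃ p r
    cases 1F 0F 0F = repeat₂₃ q p
    cases 1F 2F 2F = repeat₂₃ q r
    cases 2F 0F 0F = repeat₂₃ r p
    cases 2F 1F 1F = repeat₂₃ r q

  -- The determinant is affine in each vertex, so over a triangle it is
  -- largest at triples of vertices.
  det≤∣triangleDet∣ : ∀ T {p q r} → p ∈ closed T → q ∈ closed T → r ∈ closed T →
    det p q r ≤ ∣ triangleDet T ∣
  det≤∣triangleDet∣ T {p} {q} p∈T q∈T = closed-det-≤ T p q λ i →
    ≤-respˡ-≈ (Eq.trans (det-cyclic q (vertex T i) p) (det-cyclic (vertex T i) p q))
      (closed-det-≤ T q (vertex T i) (λ j →
        ≤-respˡ-≈ (Eq.trans (det-cyclic (vertex T i) (vertex T j) q) (det-cyclic (vertex T j) q (vertex T i)))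
          (closed-det-≤ T (vertex T i) (vertex T j) (vertices-det-≤ T i j) q∈T)) p∈T)

  -- Used in both directions, this shows that triangles equal as sets have equal areas, whatever the
  -- order of their vertices. Both orientations are needed because area takes an absolute value.
  area-mono-⊆ : ∀ {T T′} → closed T ⊆ closed T′ → area T ≤ area T′
  area-mono-⊆ {T@(triangle p q r)} {T′} T⊆T′ = *-monoʳ-≤ (proj₁ 0<½) (∣∣-lub
    (det≤∣triangleDet∣ T′ p∈ q∈ r∈)
    (≤-respˡ-≈ (det-anti p q r) (det≤∣triangleDet∣ T′ q∈ p∈ r∈)))
    where
    p∈ : p ∈ closed T′
    p∈ = T⊆T′ (vertex∈closed T 0F)
    q∈ : q ∈ closed T′
    q∈ = T⊆T′ (vertex∈closed T 1F)
    r∈ : r ∈ closed T′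
    r∈ = T⊆T′ (vertex∈closed T 2F)

  module _ (σ : Symmetry) where
    open Symmetry σ using (transpose; flipX; flipY)

    private
      swap-if : Point → Point
      swap-if (x , y) = if transpose then (y , x) else (x , y)

      flipX-if flipY-if : Point → Point
      flipX-if (x , y) = (if flipX then 1# - x else x) , y
      flipY-if (x , y) = x , (if flipY then 1# - y else y)

      ∣-∣≈ : ∀ {x y} → x ≈ - y → ∣ x ∣ ≈ ∣ y ∣
      ∣-∣≈ {y = y} x≈-y = Eq.trans (∣∣-cong x≈-y) (∣-x∣≈∣x∣ y)

      ∣det∣-swap : ∀ p q r → ∣ det (swap-if p) (swap-if q) (swap-if r) ∣ ≈ ∣ det p q r ∣
      ∣det∣-swap (x₀ , y₀) (x₁ , y₁) (x₂ , y₂) with transpose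
      ... | false = Eq.refl
      ... | true  = ∣-∣≈ (solve 6 (λ x₀ y₀ x₁ y₁ x₂ y₂ →
        (y₁ :- y₀) :* (x₂ :- x₀) :- (y₂ :- y₀) :* (x₁ :- x₀) :=
        :- ((x₁ :- x₀) :* (y₂ :- y₀) :- (x₂ :- x₀) :* (y₁ :- y₀))) Eq.refl x₀ y₀ x₁ y₁ x₂ y₂)

      ∣det∣-flipX : ∀ p q r → ∣ det (flipX-if p) (flipX-if q) (flipX-if r) ∣ ≈ ∣ det p q r ∣
      ∣det∣-flipX (x₀ , y₀) (x₁ , y₁) (x₂ , y₂) with flipX
      ... | false = Eq.refl
      ... | true  = ∣-∣≈ (solve 6 (λ x₀ y₀ x₁ y₁ x₂ y₂ →
        ((con 1ℤ :- x₁) :- (con 1ℤ :- x₀)) :* (y₂ :- y₀) :- ((con 1ℤ :- x₂) :- (con 1ℤ :- x₀)) :* (y₁ :- y₀) :=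
        :- ((x₁ :- x₀) :* (y₂ :- y₀) :- (x₂ :- x₀) :* (y₁ :- y₀))) Eq.refl x₀ y₀ x₁ y₁ x₂ y₂)

      ∣det∣-flipY : ∀ p q r → ∣ det (flipY-if p) (flipY-if q) (flipY-if r) ∣ ≈ ∣ det p q r ∣
      ∣det∣-flipY (x₀ , y₀) (x₁ , y₁) (x₂ , y₂) with flipY
      ... | false = Eq.refl
      ... | true  = ∣-∣≈ (solve 6 (λ x₀ y₀ x₁ y₁ x₂ y₂ →
        (x₁ :- x₀) :* ((con 1ℤ :- y₂) :- (con 1ℤ :- y₀)) :- (x₂ :- x₀) :* ((con 1ℤ :- y₁) :- (con 1ℤ :- y₀)) :=
        :- ((x₁ :- x₀) :* (y₂ :- y₀) :- (x₂ :- x₀) :* (y₁ :- y₀))) Eq.refl x₀ y₀ x₁ y₁ x₂ y₂)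

    -- Each of the three reflections negates the determinant, which the absolute value hides.
    area-applyTriangle : ∀ T → area (applyTriangle σ T) ≈ area T
    area-applyTriangle (triangle p q r) = *-congˡ (Eq.trans
      (∣det∣-flipY _ _ _) (Eq.trans (∣det∣-flipX _ _ _) (∣det∣-swap p q r)))

-- A decidable interval search over all direction sequences.

record Box : Set where
  constructor box
  field
    p⁻ p⁺ u⁻ u⁺ : ℕ

-- N κ and N times every area lie between lo and hi, and a box encloses N p and
-- N u. Refutable n b says that no n steps from b can end at p = u = 1.
module IntervalSearch (N lo hi : ℕ) where

  _÷_ : ℕ → ℕ → ℕ
  m ÷ zero  = 0
  m ÷ suc n = m ℕ./ suc n

  -- Mere guesses, also where the truncated subtraction gives 0: Valid checks
  -- them, so nothing about division has to be proved.
  increment⁻ increment⁺ : ℕ → ℕ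
  increment⁻ u⁻ = (2 ℕ.* lo ℕ.* (N ℕ.* N)) ÷ (N ℕ.* N ℕ.∸ 2 ℕ.* lo ℕ.* u⁻)
  increment⁺ u⁺ = suc ((2 ℕ.* hi ℕ.* (N ℕ.* N)) ÷ (N ℕ.* N ℕ.∸ 2 ℕ.* hi ℕ.* u⁺))

  -- The scaled advance d on one rail satisfies d (N² - 2KU) = 2AN², where A, K and U are N times
  -- the area, κ and the apex parameter. The fields say that `d⁻` is small enough for the least A,
  -- K, U and `d⁺` large enough for the greatest; the subtracted term stands on the other side to
  -- keep truncated subtraction out.
  record Valid (u⁻ u⁺ d⁻ d⁺ : ℕ) : Set where
    constructor valid
    field
      lower-valid : d⁻ ℕ.* (N ℕ.* N) ℕ.≤ 2 ℕ.* lo ℕ.* (N ℕ.* N) ℕ.+ 2 ℕ.* d⁻ ℕ.* (lo ℕ.* u⁻)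
      upper-valid : 2 ℕ.* hi ℕ.* (N ℕ.* N) ℕ.+ 2 ℕ.* d⁺ ℕ.* (hi ℕ.* u⁺) ℕ.≤ d⁺ ℕ.* (N ℕ.* N)

  Refutable : ℕ → Box → Set
  Refutable zero    (box p⁻ p⁺ u⁻ u⁺) = p⁺ ℕ.< N ⊎ N ℕ.< p⁻ ⊎ u⁺ ℕ.< N ⊎ N ℕ.< u⁻
  Refutable (suc n) (box p⁻ p⁺ u⁻ u⁺) =
    (Valid u⁻ u⁺ (increment⁻ u⁻) (increment⁺ u⁺) ×
     Refutable n (box (p⁻ ℕ.+ increment⁻ u⁻) (p⁺ ℕ.+ increment⁺ u⁺) u⁻ u⁺)) ×
    (Valid p⁻ p⁺ (increment⁻ p⁻) (increment⁺ p⁺) ×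
     Refutable n (box p⁻ p⁺ (u⁻ ℕ.+ increment⁻ p⁻) (u⁺ ℕ.+ increment⁺ p⁺)))

  valid? : ∀ u⁻ u⁺ d⁻ d⁺ → Dec (Valid u⁻ u⁺ d⁻ d⁺)
  valid? u⁻ u⁺ d⁻ d⁺ = map′ (uncurry valid) (λ (valid l u) → l , u) ((_ ℕ.≤? _) ×-dec (_ ℕ.≤? _))

  refutable? : ∀ n b → Dec (Refutable n b)
  refutable? zero    (box p⁻ p⁺ u⁻ u⁺) = (p⁺ ℕ.<? N) ⊎-dec (N ℕ.<? p⁻) ⊎-dec (u⁺ ℕ.<? N) ⊎-dec (N ℕ.<? u⁻)
  refutable? (suc n) (box p⁻ p⁺ u⁻ u⁺) =
    (valid? u⁻ u⁺ _ _ ×-dec refutable? n _) ×-dec (valid? p⁻ p⁺ _ _ ×-dec refutable? n _)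

-- Area bounds for the zig-zag family and the refutation of small ranges.

module Family {c ℓ₁ ℓ₂} (ℝ : CompleteOrderedField c ℓ₁ ℓ₂) where
  open OrderedField ℝ
  open Solver
  open Geometry ℝ
  open Area ℝ
  open import Relation.Binary.Reasoning.Setoid setoid

  module _ {k ν m M δ : Carrier} (0<k : 0# < k) (0≤ν : 0# ≤ ν) (ν[M-m]≤δ : ν * (M - m) ≤ δ) where

    -- M is at least the mean 1/k and the range at most δ/ν, so νm ≥ ν/k - δ ≥ lo; all of it is
    -- multiplied by k to avoid dividing.
    scaled-minimum-≥ : ∀ {lo} → 1# ≤ k * M → k * (lo + δ) ≤ ν → lo ≤ ν * m
    scaled-minimum-≥ {lo} 1≤kM k[lo+δ]≤ν = ≤-by Eq.refl (*-cancelˡ-0≤ 0<k (≤-respʳ-≈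
      (solve 6 (λ k ν m M lo δ →
        k :* (δ :- ν :* (M :- m)) :+ ν :* (k :* M :- con 1ℤ) :+ (ν :- k :* (lo :+ δ)) := k :* (ν :* m :- lo))
        Eq.refl k ν m M lo δ)
      (+-nonNegative (+-nonNegative
        (*-nonNegative (proj₁ 0<k) (x≤y⇒0≤y-x ν[M-m]≤δ)) (*-nonNegative 0≤ν (x≤y⇒0≤y-x 1≤kM)))
        (x≤y⇒0≤y-x k[lo+δ]≤ν))))

    scaled-maximum-≤ : ∀ {hi} → k * m ≤ 1# → ν + k * δ ≤ k * hi → ν * M ≤ hi
    scaled-maximum-≤ {hi} km≤1 ν+kδ≤khi = ≤-by Eq.refl (*-cancelˡ-0≤ 0<k (≤-respʳ-≈
      (solve 6 (λ k ν m M hi δ →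
        k :* (δ :- ν :* (M :- m)) :+ ν :* (con 1ℤ :- k :* m) :+ (k :* hi :- (ν :+ k :* δ)) := k :* (hi :- ν :* M))
        Eq.refl k ν m M hi δ)
      (+-nonNegative (+-nonNegative
        (*-nonNegative (proj₁ 0<k) (x≤y⇒0≤y-x ν[M-m]≤δ)) (*-nonNegative 0≤ν (x≤y⇒0≤y-x km≤1)))
        (x≤y⇒0≤y-x ν+kδ≤khi))))

  -- Advancing by δ on one rail, from apex t on the other, cuts off a triangle
  -- of area ½ δ (height κ t); this holds for both rails.
  height : (κ t : Carrier) → Carrier
  height κ t = 1# - 2# * κ * t

  module Enclosure (N lo hi : ℕ) (0<N : 0 ℕ.< N) {κ : Carrier}
    (lo≤Nκ : fromℕ lo ≤ fromℕ N * κ) (Nκ≤hi : fromℕ N * κ ≤ fromℕ hi) where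
    open IntervalSearch N lo hi

    ν : Carrier
    ν = fromℕ N

    0<ν : 0# < ν
    0<ν = fromℕ-mono-< 0<N

    0≤Nκ : 0# ≤ ν * κ
    0≤Nκ = ≤-trans (fromℕ-nonNegative lo) lo≤Nκ

    record Between (a b : ℕ) (x : Carrier) : Set ℓ₂ where
      constructor between
      field
        below : fromℕ a ≤ ν * x
        above : ν * x ≤ fromℕ b

    -- The product δ (height κ u) is twice the area cut off, hence the doubled bounds.
    BoundedIncrement : Carrier → Carrier → Set _
    BoundedIncrement u δ = 0# < height κ u × Between (2 ℕ.* lo) (2 ℕ.* hi) (δ * height κ u)

    fromℕ-*₃ : ∀ a b e → fromℕ (a ℕ.* b ℕ.* e) ≈ fromℕ a * fromℕ b * fromℕ e
    fromℕ-*₃ a b e = Eq.trans (fromℕ-* (a ℕ.* b) e) (*-congʳ (fromℕ-* a b))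

    -- Multiplied by the positive number (height κ u) ν², each claim splits into three non-negative
    -- terms: the area bound, the inequality from `Valid`, and the bound on the product of νκ and
    -- νu.
    increment-between : ∀ {u⁻ u⁺ d⁻ d⁺ u δ} → Valid u⁻ u⁺ d⁻ d⁺ →
      Between u⁻ u⁺ u → BoundedIncrement u δ → Between d⁻ d⁺ δ
    increment-between {u⁻} {u⁺} {d⁻} {d⁺} {u} {δ} (valid valid⁻ valid⁺) (between u⁻≤ ≤u⁺) (0<h , between lo≤ ≤hi) = between
      (≤-by Eq.refl (*-cancelˡ-0≤ 0<hν² (≤-respʳ-≈
        (solve 7 (λ ν κ u δ d l v →
           ν :* ν :* (ν :* (δ :* (con 1ℤ :- con (+ 2) :* κ :* u)) :- con (+ 2) :* l) :+
           (con (+ 2) :* l :* (ν :* ν) :+ con (+ 2) :* d :* (l :* v) :- d :* (ν :* ν)) :+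
           con (+ 2) :* d :* (ν :* κ :* (ν :* u) :- l :* v) :=
           (con 1ℤ :- con (+ 2) :* κ :* u) :* (ν :* ν) :* (ν :* δ :- d))
           Eq.refl ν κ u δ (fromℕ d⁻) (fromℕ lo) (fromℕ u⁻))
        (+-nonNegative (+-nonNegative
          (*-nonNegative 0≤ν² (x≤y⇒0≤y-x (≤-respˡ-≈ (fromℕ-* 2 lo) lo≤)))
          (x≤y⇒0≤y-x (≤-respˡ-≈ (Eq.trans (fromℕ-* d⁻ _) (*-congˡ (fromℕ-* N N)))
            (≤-respʳ-≈ (Eq.trans (fromℕ-+ (2 ℕ.* lo ℕ.* (N ℕ.* N)) _) (+-cong
              (Eq.trans (fromℕ-*₃ 2 lo _) (*-congˡ (fromℕ-* N N)))
              (Eq.trans (fromℕ-*₃ 2 d⁻ _) (*-congˡ (fromℕ-* lo u⁻)))))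
              (fromℕ-mono-≤ valid⁻)))))
          (*-nonNegative (*-nonNegative (proj₁ 0<2) (fromℕ-nonNegative d⁻))
            (x≤y⇒0≤y-x (*-mono-≤ (fromℕ-nonNegative lo) 0≤νu lo≤Nκ u⁻≤)))))))
      (≤-by Eq.refl (*-cancelˡ-0≤ 0<hν² (≤-respʳ-≈
        (solve 7 (λ ν κ u δ e h w →
           ν :* ν :* (con (+ 2) :* h :- ν :* (δ :* (con 1ℤ :- con (+ 2) :* κ :* u))) :+
           (e :* (ν :* ν) :- (con (+ 2) :* h :* (ν :* ν) :+ con (+ 2) :* e :* (h :* w))) :+
           con (+ 2) :* e :* (h :* w :- ν :* κ :* (ν :* u)) :=
           (con 1ℤ :- con (+ 2) :* κ :* u) :* (ν :* ν) :* (e :- ν :* δ))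
           Eq.refl ν κ u δ (fromℕ d⁺) (fromℕ hi) (fromℕ u⁺))
        (+-nonNegative (+-nonNegative
          (*-nonNegative 0≤ν² (x≤y⇒0≤y-x (≤-respʳ-≈ (fromℕ-* 2 hi) ≤hi)))
          (x≤y⇒0≤y-x (≤-respʳ-≈ (Eq.trans (fromℕ-* d⁺ _) (*-congˡ (fromℕ-* N N)))
            (≤-respˡ-≈ (Eq.trans (fromℕ-+ (2 ℕ.* hi ℕ.* (N ℕ.* N)) _) (+-cong
              (Eq.trans (fromℕ-*₃ 2 hi _) (*-congˡ (fromℕ-* N N)))
              (Eq.trans (fromℕ-*₃ 2 d⁺ _) (*-congˡ (fromℕ-* hi u⁺)))))
              (fromℕ-mono-≤ valid⁺)))))
          (*-nonNegative (*-nonNegative (proj₁ 0<2) (fromℕ-nonNegative d⁺))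
            (x≤y⇒0≤y-x (*-mono-≤ 0≤Nκ (≤-trans 0≤νu ≤u⁺) Nκ≤hi ≤u⁺)))))))
      where
      0≤νu : 0# ≤ ν * u
      0≤νu = ≤-trans (fromℕ-nonNegative u⁻) u⁻≤

      0≤ν² : 0# ≤ ν * ν
      0≤ν² = *-nonNegative (proj₁ 0<ν) (proj₁ 0<ν)

      0<hν² : 0# < height κ u * (ν * ν)
      0<hν² = *-positive 0<h (*-positive 0<ν 0<ν)

    between-+ : ∀ {p⁻ p⁺ d⁻ d⁺ p p′} → Between p⁻ p⁺ p → Between d⁻ d⁺ (p′ - p) → Between (p⁻ ℕ.+ d⁻) (p⁺ ℕ.+ d⁺) p′
    between-+ {p⁻} {p⁺} {d⁻} {d⁺} {p} {p′} (between p⁻≤ ≤p⁺) (between d⁻≤ ≤d⁺) = between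
      (≤-respˡ-≈ (Eq.sym (fromℕ-+ p⁻ d⁻)) (≤-respʳ-≈ eq (+-mono-≤ p⁻≤ d⁻≤)))
      (≤-respʳ-≈ (Eq.sym (fromℕ-+ p⁺ d⁺)) (≤-respˡ-≈ eq (+-mono-≤ ≤p⁺ ≤d⁺)))
      where
      eq : ν * p + ν * (p′ - p) ≈ ν * p′
      eq = solve 3 (λ ν p p′ → ν :* p :+ ν :* (p′ :- p) := ν :* p′) Eq.refl ν p p′

    between-cong : ∀ {a b x y} → x ≈ y → Between a b x → Between a b y
    between-cong x≈y (between a≤ ≤b) = between (≤-respʳ-≈ (*-congˡ x≈y) a≤) (≤-respˡ-≈ (*-congˡ x≈y) ≤b)

    between-1 : ∀ {a b x} → x ≈ 1# → Between a b x → ¬ (b ℕ.< N ⊎ N ℕ.< a)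
    between-1 x≈1 (between a≤ ≤b) = [ (λ b<N → <⇒≱ (fromℕ-mono-< b<N) (≤-respˡ-≈ νx≈ν ≤b)) ,
                                (λ N<a → <⇒≱ (fromℕ-mono-< N<a) (≤-respʳ-≈ νx≈ν a≤)) ]′
      where
      νx≈ν = Eq.trans (*-congˡ x≈1) (Eq.trans (*-comm ν 1#) (*-identityˡ ν))

    BoundedStep : Direction → (p p′ u u′ : Carrier) → Set _
    BoundedStep lower p p′ u u′ = BoundedIncrement u (p′ - p) × u′ ≈ u
    BoundedStep upper p p′ u u′ = BoundedIncrement p (u′ - u) × p′ ≈ p

    -- The start is any point of the box rather than the origin: after one step the remaining
    -- zig-zag begins in the enlarged box, and the induction continues with the tails of `s`, `p`
    -- and `u`.
    refutation : ∀ n {p⁻ p⁺ u⁻ u⁺} → Refutable n (box p⁻ p⁺ u⁻ u⁺) →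
      ∀ (s : Vector Direction n) (p u : Vector Carrier (suc n)) →
      Between p⁻ p⁺ (p zero) → Between u⁻ u⁺ (u zero) →
      (∀ i → BoundedStep (s i) (p (inject₁ i)) (p (suc i)) (u (inject₁ i)) (u (suc i))) →
      p (Fin.fromℕ n) ≈ 1# → ¬ u (Fin.fromℕ n) ≈ 1#
    refutation zero r s p u p∈ u∈ steps p≈1 u≈1 with r
    ... | inj₁ p⁺<N               = between-1 p≈1 p∈ (inj₁ p⁺<N)
    ... | inj₂ (inj₁ N<p⁻)        = between-1 p≈1 p∈ (inj₂ N<p⁻)
    ... | inj₂ (inj₂ (inj₁ u⁺<N)) = between-1 u≈1 u∈ (inj₁ u⁺<N)
    ... | inj₂ (inj₂ (inj₂ N<u⁻)) = between-1 u≈1 u∈ (inj₂ N<u⁻)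
    refutation (suc n) ((validᵖ , rᵖ) , (validᵘ , rᵘ)) s p u p∈ u∈ steps with s zero | steps zero
    ... | lower | bounded , u′≈u = refutation n rᵖ (s ∘ suc) (p ∘ suc) (u ∘ suc)
      (between-+ p∈ (increment-between validᵖ u∈ bounded)) (between-cong (Eq.sym u′≈u) u∈) (steps ∘ suc)
    ... | upper | bounded , p′≈p = refutation n rᵘ (s ∘ suc) (p ∘ suc) (u ∘ suc)
      (between-cong (Eq.sym p′≈p) p∈) (between-+ u∈ (increment-between validᵘ p∈ bounded)) (steps ∘ suc)

  -- As the rail parameters end at 1, this caps all of them at 1, which together with κ < ½ keeps
  -- every height positive.
  monotone-≤-last : ∀ n (v : Vector Carrier (suc n)) → (∀ i → v (inject₁ i) ≤ v (suc i)) →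
    ∀ i → v i ≤ v (Fin.fromℕ n)
  monotone-≤-last zero    v mono zero    = ≤-refl
  monotone-≤-last (suc n) v mono zero    = ≤-trans (mono zero) (monotone-≤-last n (v ∘ suc) (mono ∘ suc) zero)
  monotone-≤-last (suc n) v mono (suc i) = monotone-≤-last n (v ∘ suc) (mono ∘ suc) i

  -- A uniform bound on each drop suffices to compare n equal areas with the total drop, so the sum
  -- of the areas is never formed.
  telescope-≤ : ∀ n (v : Vector Carrier (suc n)) δ → (∀ i → v (suc i) + δ ≤ v (inject₁ i)) →
    v (Fin.fromℕ n) + fromℕ n * δ ≤ v zero
  telescope-≤ zero    v δ drop = ≤-reflexive (solve 2 (λ x δ → x :+ con 0ℤ :* δ := x) Eq.refl (v zero) δ)
  telescope-≤ (suc n) v δ drop = ≤-trans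
    (≤-respˡ-≈ (Eq.sym (Eq.trans (+-congˡ (*-congʳ (fromℕ-+ 1 n)))
        (solve 3 (λ x n δ → x :+ (con 1ℤ :+ n) :* δ := (x :+ n :* δ) :+ δ) Eq.refl _ (fromℕ n) δ)))
      (+-mono-≤ (telescope-≤ n (v ∘ suc) δ (drop ∘ suc)) ≤-refl))
    (drop zero)

  telescope-≥ : ∀ n (v : Vector Carrier (suc n)) δ → (∀ i → v (inject₁ i) ≤ v (suc i) + δ) →
    v zero ≤ v (Fin.fromℕ n) + fromℕ n * δ
  telescope-≥ n v δ drop = ≤-by
    (solve 4 (λ x y n δ → (y :+ n :* δ) :- x := :- x :- (:- y :+ n :* :- δ)) Eq.refl (v zero) _ (fromℕ n) δ)
    (x≤y⇒0≤y-x (telescope-≤ n (-_ ∘ v) (- δ) λ i → ≤-by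
      (solve 3 (λ x y δ → :- x :- (:- y :+ :- δ) := (y :+ δ) :- x) Eq.refl (v (inject₁ i)) (v (suc i)) δ)
      (x≤y⇒0≤y-x (drop i))))

  module _ {κ : Carrier} (0<κ : 0# < κ) (κ<½ : κ < ½) {n : ℕ} {s : Vector Direction n} (Z : ZigZag n s) where
    open ZigZag Z

    private
      step-p : ∀ d {p p′ u u′} → Step d p p′ u u′ → p ≤ p′
      step-p lower (p<p′ , _) = proj₁ p<p′
      step-p upper (_ , p′≈p) = ≤-reflexive (Eq.sym p′≈p)

      step-u : ∀ d {p p′ u u′} → Step d p p′ u u′ → u ≤ u′
      step-u lower (_ , u′≈u) = ≤-reflexive (Eq.sym u′≈u)
      step-u upper (u<u′ , _) = proj₁ u<u′

      p≤1 : ∀ i → p i ≤ 1#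
      p≤1 i = ≤-respʳ-≈ p-end (monotone-≤-last n p (λ i → step-p (s i) (step i)) i)

      u≤1 : ∀ i → u i ≤ 1#
      u≤1 i = ≤-respʳ-≈ u-end (monotone-≤-last n u (λ i → step-u (s i) (step i)) i)

      0<height : ∀ {t} → t ≤ 1# → 0# < height κ t
      0<height {t} t≤1 = <-respʳ-≈
        (begin
          2# * κ * (1# - t) + 2# * (½ - κ)      ≈⟨ solve 3 (λ κ t ½ →
            con (+ 2) :* κ :* (con 1ℤ :- t) :+ con (+ 2) :* (½ :- κ) :=
            con (+ 2) :* ½ :- con (+ 2) :* κ :* t) Eq.refl κ t ½ ⟩
          2# * ½ - 2# * κ * t                   ≈⟨ +-congʳ 2*½ ⟩
          height κ t                            ∎)
        (+-nonNegative-positive (*-nonNegative (*-nonNegative (proj₁ 0<2) (proj₁ 0<κ)) (x≤y⇒0≤y-x t≤1))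
                (*-positive 0<2 (x<y⇒0<y-x κ<½)))

      ½-scaled : ∀ {x y} → ∣ x ∣ ≈ y → 2# * (½ * ∣ x ∣) ≈ y
      ½-scaled {x} {y} ∣x∣≈y = begin
        2# * (½ * ∣ x ∣)   ≈⟨ solve 3 (λ a b c → a :* (b :* c) := (a :* b) :* c) Eq.refl 2# ½ _ ⟩
        2# * ½ * ∣ x ∣     ≈⟨ *-cong 2*½ ∣x∣≈y ⟩
        1# * y             ≈⟨ *-identityˡ y ⟩
        y                  ∎

      double : Direction → (p p′ u u′ : Carrier) → Carrier
      double lower p p′ u u′ = (p′ - p) * height κ u
      double upper p p′ u u′ = (u′ - u) * height κ p

      0≤double : ∀ d {p p′ u u′} → Step d p p′ u u′ → p ≤ 1# → u ≤ 1# → 0# ≤ double d p p′ u u′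
      0≤double lower (p<p′ , _) p≤1 u≤1 = *-nonNegative (x≤y⇒0≤y-x (proj₁ p<p′)) (proj₁ (0<height u≤1))
      0≤double upper (u<u′ , _) p≤1 u≤1 = *-nonNegative (x≤y⇒0≤y-x (proj₁ u<u′)) (proj₁ (0<height p≤1))

      -- A lower step gives a counterclockwise triangle and an upper step a clockwise one, whence
      -- the extra sign. The solver terms spell out `along` because they have to unfold to the
      -- vertices.
      ∣det∣≈double : ∀ d i → 0# ≤ double d (p (inject₁ i)) (p (suc i)) (u (inject₁ i)) (u (suc i)) →
        ∣ triangleDet (stepTriangle κ Z d i) ∣ ≈ double d (p (inject₁ i)) (p (suc i)) (u (inject₁ i)) (u (suc i))
      ∣det∣≈double lower i 0≤ = Eq.trans
        (∣∣-cong (solve 4 (λ κ p p′ u →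
          ((con 0ℤ :+ p′ :* (con 1ℤ :- con 0ℤ)) :- (con 0ℤ :+ p :* (con 1ℤ :- con 0ℤ))) :*
            ((con 1ℤ :+ u :* ((con 1ℤ :- con (+ 2) :* κ) :- con 1ℤ)) :- (con 0ℤ :+ p :* (con 0ℤ :- con 0ℤ))) :-
          ((con 0ℤ :+ u :* (con 1ℤ :- con 0ℤ)) :- (con 0ℤ :+ p :* (con 1ℤ :- con 0ℤ))) :*
            ((con 0ℤ :+ p′ :* (con 0ℤ :- con 0ℤ)) :- (con 0ℤ :+ p :* (con 0ℤ :- con 0ℤ))) :=
          (p′ :- p) :* (con 1ℤ :- con (+ 2) :* κ :* u))
          Eq.refl κ (p (inject₁ i)) (p (suc i)) (u (inject₁ i))))
        (0≤x⇒∣x∣≈x 0≤)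
      ∣det∣≈double upper i 0≤ = Eq.trans
        (∣∣-cong (solve 4 (λ κ p u u′ →
          ((con 0ℤ :+ u :* (con 1ℤ :- con 0ℤ)) :- (con 0ℤ :+ p :* (con 1ℤ :- con 0ℤ))) :*
            ((con 1ℤ :+ u′ :* ((con 1ℤ :- con (+ 2) :* κ) :- con 1ℤ)) :- (con 0ℤ :+ p :* (con 0ℤ :- con 0ℤ))) :-
          ((con 0ℤ :+ u′ :* (con 1ℤ :- con 0ℤ)) :- (con 0ℤ :+ p :* (con 1ℤ :- con 0ℤ))) :*
            ((con 1ℤ :+ u :* ((con 1ℤ :- con (+ 2) :* κ) :- con 1ℤ)) :- (con 0ℤ :+ p :* (con 0ℤ :- con 0ℤ))) :=
          :- ((u′ :- u) :* (con 1ℤ :- con (+ 2) :* κ :* p)))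
          Eq.refl κ (p (inject₁ i)) (u (inject₁ i)) (u (suc i))))
        (Eq.trans (∣-x∣≈∣x∣ _) (0≤x⇒∣x∣≈x 0≤))

      doubleᵢ : Fin n → Carrier
      doubleᵢ i = double (s i) (p (inject₁ i)) (p (suc i)) (u (inject₁ i)) (u (suc i))

      2*stepArea : ∀ i → 2# * area (stepTriangle κ Z (s i) i) ≈ doubleᵢ i
      2*stepArea i = ½-scaled (∣det∣≈double (s i) i
        (0≤double (s i) (step i) (p≤1 (inject₁ i)) (u≤1 (inject₁ i))))

    capArea : area (triangle S T (R κ)) ≈ κ
    capArea = *-cancel-2 (begin
      2# * area (triangle S T (R κ))   ≈⟨ ½-scaled (Eq.trans (∣∣-cong (solve 1 (λ κ →
        (con 1ℤ :- con 0ℤ) :* ((con 1ℤ :- con (+ 2) :* κ) :- con 1ℤ) :- (con 1ℤ :- con 0ℤ) :* (con 1ℤ :- con 1ℤ) :=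
        :- (con (+ 2) :* κ)) Eq.refl κ))
        (Eq.trans (∣-x∣≈∣x∣ _) (0≤x⇒∣x∣≈x (*-nonNegative (proj₁ 0<2) (proj₁ 0<κ))))) ⟩
      2# * κ                           ∎)
      where
      *-cancel-2 : ∀ {x y} → 2# * x ≈ 2# * y → x ≈ y
      *-cancel-2 2x≈2y = antisym (*-cancelˡ-≤ 0<2 (≤-reflexive 2x≈2y)) (*-cancelˡ-≤ 0<2 (≤-reflexive (Eq.sym 2x≈2y)))

    private
      -- Twice a triangle's area times 2κ is the decrease of the product of the
      -- two heights, whichever rail the step advances on.
      potential : Fin (suc n) → Carrier
      potential i = height κ (p i) * height κ (u i)

      potential-step : ∀ d {p p′ u u′} → Step d p p′ u u′ →
        height κ p′ * height κ u′ + 2# * κ * double d p p′ u u′ ≈ height κ p * height κ u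
      potential-step lower {p} {p′} {u} {u′} (_ , u′≈u) = Eq.trans
        (+-congʳ (*-congˡ (+-congˡ (-‿cong (*-congˡ u′≈u)))))
        (solve 4 (λ κ p p′ u →
          (con 1ℤ :- con (+ 2) :* κ :* p′) :* (con 1ℤ :- con (+ 2) :* κ :* u) :+
            con (+ 2) :* κ :* ((p′ :- p) :* (con 1ℤ :- con (+ 2) :* κ :* u)) :=
          (con 1ℤ :- con (+ 2) :* κ :* p) :* (con 1ℤ :- con (+ 2) :* κ :* u)) Eq.refl κ p p′ u)
      potential-step upper {p} {p′} {u} {u′} (_ , p′≈p) = Eq.trans
        (+-congʳ (*-congʳ (+-congˡ (-‿cong (*-congˡ p′≈p)))))
        (solve 4 (λ κ p u u′ →
          (con 1ℤ :- con (+ 2) :* κ :* p) :* (con 1ℤ :- con (+ 2) :* κ :* u′) :+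
            con (+ 2) :* κ :* ((u′ :- u) :* (con 1ℤ :- con (+ 2) :* κ :* p)) :=
          (con 1ℤ :- con (+ 2) :* κ :* p) :* (con 1ℤ :- con (+ 2) :* κ :* u)) Eq.refl κ p u u′)

      potential-drop : ∀ i → potential (inject₁ i) ≈ potential (suc i) + 2# * κ * (2# * area (stepTriangle κ Z (s i) i))
      potential-drop i = Eq.sym (Eq.trans (+-congˡ (*-congˡ (2*stepArea i))) (potential-step (s i) (step i)))

      potential-first : potential zero ≈ 1#
      potential-first = Eq.trans
        (*-cong (+-congˡ (-‿cong (*-congˡ p-start))) (+-congˡ (-‿cong (*-congˡ u-start))))
        (solve 1 (λ κ → (con 1ℤ :- con (+ 2) :* κ :* con 0ℤ) :* (con 1ℤ :- con (+ 2) :* κ :* con 0ℤ) := con 1ℤ) Eq.refl κ)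

      -- (1 - 2κ)² is written so as to show the total drop as 4κ (1 - κ), that is, 4κ times the area
      -- of the trapezoid; the factor 4κ can then be cancelled.
      potential-last : potential (Fin.fromℕ n) ≈ 1# - 2# * κ * 2# * (1# - κ)
      potential-last = Eq.trans
        (*-cong (+-congˡ (-‿cong (*-congˡ p-end))) (+-congˡ (-‿cong (*-congˡ u-end))))
        (solve 1 (λ κ → (con 1ℤ :- con (+ 2) :* κ :* con 1ℤ) :* (con 1ℤ :- con (+ 2) :* κ :* con 1ℤ) :=
          con 1ℤ :- con (+ 2) :* κ :* con (+ 2) :* (con 1ℤ :- κ)) Eq.refl κ)

      0<4κ : 0# < 2# * κ * 2#
      0<4κ = <-respʳ-≈ (*-comm 2# (2# * κ)) (*-positive 0<2 (*-positive 0<2 0<κ))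

    module _ {m M : Carrier}
      (m≤areas : ∀ j → m ≤ area (singleCapTwoRail κ Z j))
      (areas≤M : ∀ j → area (singleCapTwoRail κ Z j) ≤ M) where

      m≤κ : m ≤ κ
      m≤κ = ≤-respʳ-≈ capArea (m≤areas zero)

      κ≤M : κ ≤ M
      κ≤M = ≤-respˡ-≈ capArea (areas≤M zero)

      -- The n steps fill area 1 - κ, so nm ≤ 1 - κ, and the cap supplies the remaining m ≤ κ.
      [1+n]m≤1 : fromℕ (suc n) * m ≤ 1#
      [1+n]m≤1 = ≤-by
        (begin
          1# - fromℕ (suc n) * m                ≈⟨ +-congˡ (-‿cong (*-congʳ (fromℕ-+ 1 n))) ⟩
          1# - (1# + fromℕ n) * m               ≈⟨ solve 3 (λ n m κ →
            con 1ℤ :- (con 1ℤ :+ n) :* m := (con 1ℤ :- κ :- n :* m) :+ (κ :- m)) Eq.refl (fromℕ n) m κ ⟩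
          (1# - κ - fromℕ n * m) + (κ - m)      ∎)
        (+-nonNegative
          (*-cancelˡ-0≤ 0<4κ (≤-respʳ-≈
            (solve 3 (λ n m κ →
              con 1ℤ :- ((con 1ℤ :- con (+ 2) :* κ :* con (+ 2) :* (con 1ℤ :- κ)) :+ n :* (con (+ 2) :* κ :* (con (+ 2) :* m))) :=
              con (+ 2) :* κ :* con (+ 2) :* (con 1ℤ :- κ :- n :* m)) Eq.refl (fromℕ n) m κ)
            (x≤y⇒0≤y-x (≤-respˡ-≈ (+-congʳ potential-last) (≤-respʳ-≈ potential-first
              (telescope-≤ n potential (2# * κ * (2# * m)) λ i →
                ≤-respʳ-≈ (Eq.sym (potential-drop i)) (+-mono-≤ ≤-refl
                  (*-monoʳ-≤ 0≤2κ (*-monoʳ-≤ (proj₁ 0<2) (m≤areas (suc i)))))))))))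
          (x≤y⇒0≤y-x m≤κ))
        where
        0≤2κ : 0# ≤ 2# * κ
        0≤2κ = *-nonNegative (proj₁ 0<2) (proj₁ 0<κ)

      1≤[1+n]M : 1# ≤ fromℕ (suc n) * M
      1≤[1+n]M = ≤-by
        (begin
          fromℕ (suc n) * M - 1#                ≈⟨ +-congʳ (*-congʳ (fromℕ-+ 1 n)) ⟩
          (1# + fromℕ n) * M - 1#               ≈⟨ solve 3 (λ n m κ →
            (con 1ℤ :+ n) :* m :- con 1ℤ := (n :* m :- (con 1ℤ :- κ)) :+ (m :- κ)) Eq.refl (fromℕ n) M κ ⟩
          (fromℕ n * M - (1# - κ)) + (M - κ)    ∎)
        (+-nonNegative
          (*-cancelˡ-0≤ 0<4κ (≤-respʳ-≈
            (solve 3 (λ n m κ →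
              ((con 1ℤ :- con (+ 2) :* κ :* con (+ 2) :* (con 1ℤ :- κ)) :+ n :* (con (+ 2) :* κ :* (con (+ 2) :* m))) :- con 1ℤ :=
              con (+ 2) :* κ :* con (+ 2) :* (n :* m :- (con 1ℤ :- κ))) Eq.refl (fromℕ n) M κ)
            (x≤y⇒0≤y-x (≤-respʳ-≈ (+-congʳ potential-last) (≤-respˡ-≈ potential-first
              (telescope-≥ n potential (2# * κ * (2# * M)) λ i →
                ≤-respˡ-≈ (Eq.sym (potential-drop i)) (+-mono-≤ ≤-refl
                  (*-monoʳ-≤ 0≤2κ (*-monoʳ-≤ (proj₁ 0<2) (areas≤M (suc i)))))))))))
          (x≤y⇒0≤y-x κ≤M))
        where
        0≤2κ : 0# ≤ 2# * κ
        0≤2κ = *-nonNegative (proj₁ 0<2) (proj₁ 0<κ)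

      -- The two numerical hypotheses say that `lo` and `hi` enclose everything within δ of the
      -- scaled mean N / (n + 1). The search starts from the degenerate box because both rails start
      -- at 0.
      areaRange-lower-bound : ∀ {N lo hi δ} → 0 ℕ.< N →
        suc n ℕ.* (lo ℕ.+ δ) ℕ.≤ N → N ℕ.+ suc n ℕ.* δ ℕ.≤ suc n ℕ.* hi →
        IntervalSearch.Refutable N lo hi n (box 0 0 0 0) →
        ¬ fromℕ N * (M - m) ≤ fromℕ δ
      areaRange-lower-bound {N} {lo} {hi} {δ} 0<N [1+n][lo+δ]≤N N+[1+n]δ≤[1+n]hi refutable N[M-m]≤δ =
        refutation n refutable s p u (at-start p-start) (at-start u-start)
          (λ i → bounded (s i) i (step i) (p≤1 (inject₁ i)) (u≤1 (inject₁ i)) (2*stepArea i))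
          p-end u-end
        where
        ν : Carrier
        ν = fromℕ N

        0≤ν : 0# ≤ ν
        0≤ν = fromℕ-nonNegative N

        0<1+n : 0# < fromℕ (suc n)
        0<1+n = fromℕ-mono-< {0} {suc n} (ℕ.s≤s ℕ.z≤n)

        lo≤νm : fromℕ lo ≤ ν * m
        lo≤νm = scaled-minimum-≥ 0<1+n 0≤ν N[M-m]≤δ 1≤[1+n]M
          (≤-respˡ-≈ (Eq.trans (fromℕ-* (suc n) (lo ℕ.+ δ)) (*-congˡ (fromℕ-+ lo δ)))
            (fromℕ-mono-≤ [1+n][lo+δ]≤N))

        νM≤hi : ν * M ≤ fromℕ hi
        νM≤hi = scaled-maximum-≤ 0<1+n 0≤ν N[M-m]≤δ [1+n]m≤1
          (≤-respʳ-≈ (fromℕ-* (suc n) hi)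
            (≤-respˡ-≈ (Eq.trans (fromℕ-+ N (suc n ℕ.* δ)) (+-congˡ (fromℕ-* (suc n) δ)))
              (fromℕ-mono-≤ N+[1+n]δ≤[1+n]hi)))

        bounds : ∀ {x} → m ≤ x → x ≤ M → fromℕ lo ≤ ν * x × ν * x ≤ fromℕ hi
        bounds m≤x x≤M = ≤-trans lo≤νm (*-monoʳ-≤ 0≤ν m≤x) , ≤-trans (*-monoʳ-≤ 0≤ν x≤M) νM≤hi

        κ-bounds : fromℕ lo ≤ ν * κ × ν * κ ≤ fromℕ hi
        κ-bounds = bounds m≤κ κ≤M

        lo≤νκ : fromℕ lo ≤ ν * κ
        lo≤νκ = proj₁ κ-bounds

        νκ≤hi : ν * κ ≤ fromℕ hi
        νκ≤hi = proj₂ κ-bounds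

        open Enclosure N lo hi 0<N lo≤νκ νκ≤hi using (Between; between; BoundedStep; refutation)

        at-start : ∀ {x} → x ≈ 0# → Between 0 0 x
        at-start {x} x≈0 = between (≤-reflexive (Eq.sym νx≈0)) (≤-reflexive νx≈0)
          where
          νx≈0 : ν * x ≈ 0#
          νx≈0 = Eq.trans (*-congˡ x≈0) (zeroʳ ν)

        doubled : ∀ i {x} → 2# * area (stepTriangle κ Z (s i) i) ≈ x →
          Between (2 ℕ.* lo) (2 ℕ.* hi) x
        doubled i {x} 2a≈x = between
          (≤-respˡ-≈ (Eq.sym (fromℕ-* 2 lo)) (≤-respʳ-≈ 2νa≈νx (*-monoʳ-≤ (proj₁ 0<2) (proj₁ a-bounds))))
          (≤-respʳ-≈ (Eq.sym (fromℕ-* 2 hi)) (≤-respˡ-≈ 2νa≈νx (*-monoʳ-≤ (proj₁ 0<2) (proj₂ a-bounds))))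
          where
          a-bounds : fromℕ lo ≤ ν * area (stepTriangle κ Z (s i) i) × ν * area (stepTriangle κ Z (s i) i) ≤ fromℕ hi
          a-bounds = bounds (m≤areas (suc i)) (areas≤M (suc i))

          2νa≈νx : 2# * (ν * area (stepTriangle κ Z (s i) i)) ≈ ν * x
          2νa≈νx = Eq.trans
            (solve 2 (λ ν a → con (+ 2) :* (ν :* a) := ν :* (con (+ 2) :* a)) Eq.refl ν _)
            (*-congˡ 2a≈x)

        bounded : ∀ d i {p p′ u u′} → Step d p p′ u u′ → p ≤ 1# → u ≤ 1# →
          2# * area (stepTriangle κ Z (s i) i) ≈ double d p p′ u u′ →
          BoundedStep d p p′ u u′
        bounded lower i (_ , u′≈u) p≤1 u≤1 2a≈ = (0<height u≤1 , doubled i 2a≈) , u′≈u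
        bounded upper i (_ , p′≈p) p≤1 u≤1 2a≈ = (0<height p≤1 , doubled i 2a≈) , p′≈p

-- Integer certificates for dissections on a grid.

GridPoint : Set
GridPoint = ℤ × ℤ

-- (u , v , k) stands for the function u x + v y + k.
Line : Set
Line = ℤ × ℤ × ℤ

opposite : Line → Line
opposite (u , v , k) = ℤ.- u , ℤ.- v , ℤ.- k

_at_ : Line → GridPoint → ℤ
(u , v , k) at (a , b) = u ℤ.* a ℤ.+ v ℤ.* b ℤ.+ k

opposite-at : ∀ L p → opposite L at p ≡ ℤ.- (L at p)
opposite-at (u , v , k) (a , b) = begin
  ℤ.- u ℤ.* a ℤ.+ ℤ.- v ℤ.* b ℤ.+ ℤ.- k
    ≡⟨ ≡.cong (ℤ._+ ℤ.- k) (≡.cong₂ ℤ._+_ (ℤ.neg-distribˡ-* u a) (ℤ.neg-distribˡ-* v b)) ⟨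
  ℤ.- (u ℤ.* a) ℤ.+ ℤ.- (v ℤ.* b) ℤ.+ ℤ.- k
    ≡⟨ ≡.cong (ℤ._+ ℤ.- k) (ℤ.neg-distrib-+ (u ℤ.* a) (v ℤ.* b)) ⟨
  ℤ.- (u ℤ.* a ℤ.+ v ℤ.* b) ℤ.+ ℤ.- k
    ≡⟨ ℤ.neg-distrib-+ (u ℤ.* a ℤ.+ v ℤ.* b) k ⟨
  ℤ.- (u ℤ.* a ℤ.+ v ℤ.* b ℤ.+ k) ∎
  where open ≡-Reasoning

-- Positive to the left of the segment directed from the first point to the second.
through : GridPoint → GridPoint → Line
through (a , b) (a′ , b′) = b ℤ.- b′ , a′ ℤ.- a , a ℤ.* b′ ℤ.- a′ ℤ.* b

GridTriangle : Set
GridTriangle = Fin 3 → GridPoint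

corners : (p q r : GridPoint) → GridTriangle
corners p q r 0F = p
corners p q r 1F = q
corners p q r 2F = r

next : Fin 3 → Fin 3
next 0F = 1F
next 1F = 2F
next 2F = 0F

-- The side opposite the vertex i, non-negative on a counterclockwise triangle.
side : GridTriangle → Fin 3 → Line
side t i = through (t (next i)) (t (next (next i)))

doubleArea : GridTriangle → ℤ
doubleArea t = side t 2F at t 2F

-- A binary space partition certifying coverage: each leaf names one triangle that contains the
-- whole region reached there.
data Partition (n : ℕ) : Set where
  cell : Fin n → Partition n
  cut  : Line → (left right : Partition n) → Partition n

Separates : Line → GridTriangle → GridTriangle → Set
Separates L@(u , v , _) t t′ =
  (∀ i → 0ℤ ℤ.≤ L at t i) × (∀ i → L at t′ i ℤ.≤ 0ℤ) × 0ℤ ℤ.< u ℤ.* u ℤ.+ v ℤ.* v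

-- The second line is s′ / s times the first.
_Implies_ : Line → Line → Set
L@(u , v , k) Implies (u′ , v′ , k′) =
  0ℤ ℤ.< s × 0ℤ ℤ.≤ s′ × s ℤ.* u′ ≡ s′ ℤ.* u × s ℤ.* v′ ≡ s′ ℤ.* v × s ℤ.* k′ ≡ s′ ℤ.* k
  where
  s s′ : ℤ
  s  = u ℤ.* u ℤ.+ v ℤ.* v
  s′ = u ℤ.* u′ ℤ.+ v ℤ.* v′

-- Γ collects the half-planes met on the way down. At a leaf every side of the triangle has to be a
-- rescaled member of Γ, so that no linear combinations need checking.
Covers : ∀ {n} → Vector GridTriangle n → List Line → Partition n → Set
Covers ts Γ (cell i)    = ∀ j → Any (_Implies side (ts i) j) Γ
Covers ts Γ (cut L l r) = Covers ts (L ∷ Γ) l × Covers ts (opposite L ∷ Γ) r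

squareSides : ℕ → List Line
squareSides N = (+ 1 , + 0 , + 0) ∷ (ℤ.- + 1 , + 0 , + N) ∷ (+ 0 , + 1 , + 0) ∷ (+ 0 , ℤ.- + 1 , + N) ∷ []

InSquare : ℕ → GridTriangle → Set
InSquare N t = All (λ L → ∀ i → 0ℤ ℤ.≤ L at t i) (squareSides N)

record IsGridDissection {n} (N lo hi : ℕ) (ts : Vector GridTriangle n) (partition : Partition n) : Set where
  constructor isGridDissection
  field
    0<N         : 0 ℕ.< N
    0<lo        : 0 ℕ.< lo
    doubleAreas : ∀ i → + lo ℤ.≤ doubleArea (ts i) × doubleArea (ts i) ℤ.≤ + hi
    inSquare    : ∀ i → InSquare N (ts i)
    separated   : ∀ i j → i ≡ j ⊎
                  (∃[ k ] Separates (side (ts i) k) (ts i) (ts j)) ⊎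
                  (∃[ k ] Separates (side (ts j) k) (ts j) (ts i))
    covers      : Covers ts (squareSides N) partition

separates? : ∀ L t t′ → Dec (Separates L t t′)
separates? L t t′ =
  Fin.all? (λ i → _ ℤ.≤? _) ×-dec Fin.all? (λ i → _ ℤ.≤? _) ×-dec (_ ℤ.<? _)

implies? : ∀ L L′ → Dec (L Implies L′)
implies? L L′ = (_ ℤ.<? _) ×-dec (_ ℤ.≤? _) ×-dec (_ ℤ.≟ _) ×-dec (_ ℤ.≟ _) ×-dec (_ ℤ.≟ _)

covers? : ∀ {n} (ts : Vector GridTriangle n) Γ p → Dec (Covers ts Γ p)
covers? ts Γ (cell i)    = Fin.all? λ j → any? (λ L → implies? L (side (ts i) j)) Γ
covers? ts Γ (cut L l r) = covers? ts (L ∷ Γ) l ×-dec covers? ts (opposite L ∷ Γ) r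

isGridDissection? : ∀ {n} N lo hi (ts : Vector GridTriangle n) p → Dec (IsGridDissection N lo hi ts p)
isGridDissection? N lo hi ts p = map′
  (λ (a , b , c , d , e , f) → isGridDissection a b c d e f)
  (λ (isGridDissection a b c d e f) → a , b , c , d , e , f)
  ((0 ℕ.<? N) ×-dec (0 ℕ.<? lo) ×-dec
   Fin.all? (λ i → (_ ℤ.≤? _) ×-dec (_ ℤ.≤? _)) ×-dec
   Fin.all? (λ i → All.all? (λ L → Fin.all? λ j → 0ℤ ℤ.≤? L at ts i j) (squareSides N)) ×-dec
   Fin.all? (λ i → Fin.all? λ j → (i Fin.≟ j) ⊎-dec
     Fin.any? (λ k → separates? (side (ts i) k) (ts i) (ts j)) ⊎-dec
     Fin.any? (λ k → separates? (side (ts j) k) (ts j) (ts i))) ×-dec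
   covers? ts (squareSides N) p)

-- Bounds for the maximum and minimum of a vector.

module Extrema {c ℓ₁ ℓ₂} (ℝ : CompleteOrderedField c ℓ₁ ℓ₂) where
  open OrderedField ℝ
  open Geometry ℝ

  private
    z≤foldr-max : ∀ {n} z (xs : Vector Carrier n) → z ≤ foldr max z xs
    z≤foldr-max {zero}  z xs = ≤-refl
    z≤foldr-max {suc n} z xs = ≤-trans (z≤foldr-max z (tail xs)) (MaxProperties.x≤y⊔x (head xs) _)

    xs≤foldr-max : ∀ {n} z (xs : Vector Carrier n) i → xs i ≤ foldr max z xs
    xs≤foldr-max z xs zero    = MaxProperties.x≤x⊔y (head xs) _
    xs≤foldr-max z xs (suc i) = ≤-trans (xs≤foldr-max z (tail xs) i) (MaxProperties.x≤y⊔x (head xs) _)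

    foldr-max-lub : ∀ {n z b} (xs : Vector Carrier n) → z ≤ b → (∀ i → xs i ≤ b) → foldr max z xs ≤ b
    foldr-max-lub {zero}  xs z≤b xs≤b = z≤b
    foldr-max-lub {suc n} xs z≤b xs≤b = MaxProperties.⊔-lub (xs≤b zero) (foldr-max-lub (tail xs) z≤b (xs≤b ∘ suc))

    foldr-min≤z : ∀ {n} z (xs : Vector Carrier n) → foldr min z xs ≤ z
    foldr-min≤z {zero}  z xs = ≤-refl
    foldr-min≤z {suc n} z xs = ≤-trans (MinProperties.x⊓y≤y (head xs) _) (foldr-min≤z z (tail xs))

    foldr-min≤xs : ∀ {n} z (xs : Vector Carrier n) i → foldr min z xs ≤ xs i
    foldr-min≤xs z xs zero    = MinProperties.x⊓y≤x (head xs) _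
    foldr-min≤xs z xs (suc i) = ≤-trans (MinProperties.x⊓y≤y (head xs) _) (foldr-min≤xs z (tail xs) i)

    foldr-min-glb : ∀ {n z b} (xs : Vector Carrier n) → b ≤ z → (∀ i → b ≤ xs i) → b ≤ foldr min z xs
    foldr-min-glb {zero}  xs b≤z b≤xs = b≤z
    foldr-min-glb {suc n} xs b≤z b≤xs = MinProperties.⊓-glb (b≤xs zero) (foldr-min-glb (tail xs) b≤z (b≤xs ∘ suc))

  xs≤maximum : ∀ {n} (xs : Vector Carrier (suc n)) i → xs i ≤ maximum xs
  xs≤maximum xs zero    = z≤foldr-max (head xs) (tail xs)
  xs≤maximum xs (suc i) = xs≤foldr-max (head xs) (tail xs) i

  maximum-lub : ∀ {n b} (xs : Vector Carrier (suc n)) → (∀ i → xs i ≤ b) → maximum xs ≤ b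
  maximum-lub xs xs≤b = foldr-max-lub (tail xs) (xs≤b zero) (xs≤b ∘ suc)

  minimum≤xs : ∀ {n} (xs : Vector Carrier (suc n)) i → minimum xs ≤ xs i
  minimum≤xs xs zero    = foldr-min≤z (head xs) (tail xs)
  minimum≤xs xs (suc i) = foldr-min≤xs (head xs) (tail xs) i

  minimum-glb : ∀ {n b} (xs : Vector Carrier (suc n)) → (∀ i → b ≤ xs i) → b ≤ minimum xs
  minimum-glb xs b≤xs = foldr-min-glb (tail xs) (b≤xs zero) (b≤xs ∘ suc)

-- Soundness of grid certificates.

module Grid {c ℓ₁ ℓ₂} (ℝ : CompleteOrderedField c ℓ₁ ℓ₂) {N : ℕ} (0<N : 0 ℕ.< N) where
  open OrderedField ℝ
  open Solver
  open Geometry ℝ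
  open Area ℝ
  open Extrema ℝ
  open import Relation.Binary.Reasoning.Setoid setoid

  ε : Carrier
  ε = fromℕ N ⁻¹⟨ fromℕ-mono-< 0<N ⟩

  N*ε≈1 : fromℕ N * ε ≈ 1#
  N*ε≈1 = ⁻¹-inverse (fromℕ N) (fromℕ-mono-< 0<N)

  0<ε : 0# < ε
  0<ε = ⁻¹-positive (fromℕ-mono-< 0<N) N*ε≈1

  embed : GridPoint → Point
  embed (a , b) = ε * fromℤ a , ε * fromℤ b

  embedTriangle : GridTriangle → Triangle
  embedTriangle t = triangle (embed (t 0F)) (embed (t 1F)) (embed (t 2F))

  -- Only the constant term is scaled: embedded coordinates already carry the factor ε, so at a grid
  -- point the value is ε times the integer one.
  value : Line → Point → Carrier
  value (u , v , k) = affine (fromℤ u) (fromℤ v) (ε * fromℤ k)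

  value-embed : ∀ L p → value L (embed p) ≈ ε * fromℤ (L at p)
  value-embed (u , v , k) (a , b) = begin
    fromℤ u * (ε * fromℤ a) + fromℤ v * (ε * fromℤ b) + ε * fromℤ k
      ≈⟨ solve 6 (λ ε u v k a b → u :* (ε :* a) :+ v :* (ε :* b) :+ ε :* k := ε :* (u :* a :+ v :* b :+ k))
           Eq.refl ε (fromℤ u) (fromℤ v) (fromℤ k) (fromℤ a) (fromℤ b) ⟩
    ε * (fromℤ u * fromℤ a + fromℤ v * fromℤ b + fromℤ k)
      ≈⟨ *-congˡ (Eq.trans (fromℤ-+ (u ℤ.* a ℤ.+ v ℤ.* b) k) (+-congʳ (Eq.trans (fromℤ-+ (u ℤ.* a) _) (+-cong (fromℤ-* u a) (fromℤ-* v b))))) ⟨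
    ε * fromℤ (u ℤ.* a ℤ.+ v ℤ.* b ℤ.+ k) ∎

  value-opposite : ∀ L p → value (opposite L) p ≈ - value L p
  value-opposite (u , v , k) (x , y) = Eq.trans
    (+-cong (+-cong (*-congʳ (fromℤ-neg u)) (*-congʳ (fromℤ-neg v))) (*-congˡ (fromℤ-neg k)))
    (solve 6 (λ ε u v k x y → :- u :* x :+ :- v :* y :+ ε :* :- k := :- (u :* x :+ v :* y :+ ε :* k))
      Eq.refl ε (fromℤ u) (fromℤ v) (fromℤ k) x y)

  -- Up to the factor ε, the determinant of the points a, b and (x , y).
  value-through : (p q : GridPoint) (r : Point) → let (a , b) = p ; (a′ , b′) = q ; (x , y) = r in
    value (through p q) r ≈
    (fromℤ b - fromℤ b′) * x + (fromℤ a′ - fromℤ a) * y + ε * (fromℤ a * fromℤ b′ - fromℤ a′ * fromℤ b)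
  value-through (a , b) (a′ , b′) (x , y) = +-cong
    (+-cong (*-congʳ (fromℤ-sub b b′)) (*-congʳ (fromℤ-sub a′ a)))
    (*-congˡ (Eq.trans (fromℤ-sub (a ℤ.* b′) _) (+-cong (fromℤ-* a b′) (-‿cong (fromℤ-* a′ b)))))

  det-embed : ∀ t → triangleDet (embedTriangle t) ≈ ε * (ε * fromℤ (doubleArea t))
  det-embed t = let (a₀ , b₀) = t 0F ; (a₁ , b₁) = t 1F ; (a₂ , b₂) = t 2F in begin
    triangleDet (embedTriangle t)
      ≈⟨ solve 7 (λ ε a₀ b₀ a₁ b₁ a₂ b₂ →
           (ε :* a₁ :- ε :* a₀) :* (ε :* b₂ :- ε :* b₀) :- (ε :* a₂ :- ε :* a₀) :* (ε :* b₁ :- ε :* b₀) :=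
           ε :* ((b₀ :- b₁) :* (ε :* a₂) :+ (a₁ :- a₀) :* (ε :* b₂) :+ ε :* (a₀ :* b₁ :- a₁ :* b₀)))
           Eq.refl ε (fromℤ a₀) (fromℤ b₀) (fromℤ a₁) (fromℤ b₁) (fromℤ a₂) (fromℤ b₂) ⟩
    ε * _                                     ≈⟨ *-congˡ (value-through (t 0F) (t 1F) (embed (t 2F))) ⟨
    ε * value (side t 2F) (embed (t 2F))      ≈⟨ *-congˡ (value-embed (side t 2F) (t 2F)) ⟩
    ε * (ε * fromℤ (doubleArea t))            ∎

  vertex-embed : ∀ t i → vertex (embedTriangle t) i ≡ embed (t i)
  vertex-embed t 0F = ≡.refl
  vertex-embed t 1F = ≡.refl
  vertex-embed t 2F = ≡.refl

  closed-value-0≤ : ∀ t L → (∀ i → 0ℤ ℤ.≤ L at t i) → ∀ {p} → p ∈ closed (embedTriangle t) → 0# ≤ value L p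
  closed-value-0≤ t L@(u , v , k) 0≤L = closed-affine-0≤ (embedTriangle t) (fromℤ u) (fromℤ v) (ε * fromℤ k) λ i →
    ≡.subst (λ p → 0# ≤ value L p) (≡.sym (vertex-embed t i))
      (≤-respʳ-≈ (Eq.sym (value-embed L (t i))) (*-nonNegative (proj₁ 0<ε) (fromℤ-mono-≤ (0≤L i))))

  closed-value-≤0 : ∀ t L → (∀ i → L at t i ℤ.≤ 0ℤ) → ∀ {p} → p ∈ closed (embedTriangle t) → value L p ≤ 0#
  closed-value-≤0 t L@(u , v , k) L≤0 {p} p∈t = ≤-by
    (Eq.trans (+-identityˡ _) (Eq.sym (value-opposite L p)))
    (closed-value-0≤ t (opposite L) (λ i → ≡.subst (0ℤ ℤ.≤_) (≡.sym (opposite-at L (t i))) (ℤ.neg-mono-≤ (L≤0 i))) p∈t)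

  implies-sound : ∀ L L′ → L Implies L′ → ∀ {p} → 0# ≤ value L p → 0# ≤ value L′ p
  implies-sound (u , v , k) (u′ , v′ , k′) (0<s , 0≤s′ , su′≡s′u , sv′≡s′v , sk′≡s′k) {x , y} 0≤L =
    *-cancelˡ-0≤ (fromℤ-positive 0<s) (≤-respʳ-≈ (begin
      s′ * (fromℤ u * x + fromℤ v * y + ε * fromℤ k)
        ≈⟨ solve 7 (λ ε s u v k x y → s :* (u :* x :+ v :* y :+ ε :* k) := (s :* u) :* x :+ (s :* v) :* y :+ ε :* (s :* k))
             Eq.refl ε s′ (fromℤ u) (fromℤ v) (fromℤ k) x y ⟩
      (s′ * fromℤ u) * x + (s′ * fromℤ v) * y + ε * (s′ * fromℤ k)
        ≈⟨ +-cong (+-cong (*-congʳ (homo u′ u su′≡s′u)) (*-congʳ (homo v′ v sv′≡s′v))) (*-congˡ (homo k′ k sk′≡s′k)) ⟨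
      (s * fromℤ u′) * x + (s * fromℤ v′) * y + ε * (s * fromℤ k′)
        ≈⟨ solve 7 (λ ε s u v k x y → s :* (u :* x :+ v :* y :+ ε :* k) := (s :* u) :* x :+ (s :* v) :* y :+ ε :* (s :* k))
             Eq.refl ε s (fromℤ u′) (fromℤ v′) (fromℤ k′) x y ⟨
      s * (fromℤ u′ * x + fromℤ v′ * y + ε * fromℤ k′) ∎)
      (*-nonNegative (fromℤ-mono-≤ 0≤s′) 0≤L))
    where
    sᶻ s′ᶻ : ℤ
    sᶻ  = u ℤ.* u ℤ.+ v ℤ.* v
    s′ᶻ = u ℤ.* u′ ℤ.+ v ℤ.* v′

    s s′ : Carrier
    s  = fromℤ sᶻ
    s′ = fromℤ s′ᶻ

    homo : ∀ i j → sᶻ ℤ.* i ≡ s′ᶻ ℤ.* j → s * fromℤ i ≈ s′ * fromℤ j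
    homo i j si≡s′j = begin
      s * fromℤ i          ≈⟨ fromℤ-* sᶻ i ⟨
      fromℤ (sᶻ ℤ.* i)     ≡⟨ ≡.cong fromℤ si≡s′j ⟩
      fromℤ (s′ᶻ ℤ.* j)    ≈⟨ fromℤ-* s′ᶻ j ⟩
      s′ * fromℤ j         ∎

  -- The barycentric coordinates are the values of the three sides at the point, divided by the
  -- value d of the last side at its opposite vertex. That they sum to 1 and reproduce the point are
  -- polynomial identities.
  sides-0≤⇒∈closed : ∀ t → 0ℤ ℤ.< doubleArea t → ∀ {p} → (∀ i → 0# ≤ value (side t i) p) → p ∈ closed (embedTriangle t)
  sides-0≤⇒∈closed t 0<D {p@(x , y)} 0≤sides =
    d⁻¹ * α₀ , d⁻¹ * α₁ , d⁻¹ * α₂ , nonNegative 0F , nonNegative 1F , nonNegative 2F ,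
    (begin
      d⁻¹ * α₀ + d⁻¹ * α₁ + d⁻¹ * α₂
        ≈⟨ solve 4 (λ d a b c → d :* a :+ d :* b :+ d :* c := d :* (a :+ b :+ c)) Eq.refl d⁻¹ α₀ α₁ α₂ ⟩
      d⁻¹ * (α₀ + α₁ + α₂)
        ≈⟨ *-congˡ (+-cong (+-cong (value-through (t 1F) (t 2F) p) (value-through (t 2F) (t 0F) p)) (value-through (t 0F) (t 1F) p)) ⟩
      d⁻¹ * (E a₁ b₁ a₂ b₂ x y + E a₂ b₂ a₀ b₀ x y + E a₀ b₀ a₁ b₁ x y)
        ≈⟨ *-congˡ (solve 9 (λ ε x y a₀ b₀ a₁ b₁ a₂ b₂ → E′ ε a₁ b₁ a₂ b₂ x y :+ E′ ε a₂ b₂ a₀ b₀ x y :+ E′ ε a₀ b₀ a₁ b₁ x y :=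
             E′ ε a₀ b₀ a₁ b₁ (ε :* a₂) (ε :* b₂)) Eq.refl ε x y a₀ b₀ a₁ b₁ a₂ b₂) ⟩
      d⁻¹ * E a₀ b₀ a₁ b₁ (ε * a₂) (ε * b₂)
        ≈⟨ *-congˡ (value-through (t 0F) (t 1F) (embed (t 2F))) ⟨
      d⁻¹ * d
        ≈⟨ d⁻¹*d≈1 ⟩
      1# ∎) ,
    coordinate a₀ a₁ a₂ x (solve 9 (λ ε x y a₀ b₀ a₁ b₁ a₂ b₂ →
      E′ ε a₁ b₁ a₂ b₂ x y :* (ε :* a₀) :+ E′ ε a₂ b₂ a₀ b₀ x y :* (ε :* a₁) :+ E′ ε a₀ b₀ a₁ b₁ x y :* (ε :* a₂) :=
      E′ ε a₀ b₀ a₁ b₁ (ε :* a₂) (ε :* b₂) :* x) Eq.refl ε x y a₀ b₀ a₁ b₁ a₂ b₂) ,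
    coordinate b₀ b₁ b₂ y (solve 9 (λ ε x y a₀ b₀ a₁ b₁ a₂ b₂ →
      E′ ε a₁ b₁ a₂ b₂ x y :* (ε :* b₀) :+ E′ ε a₂ b₂ a₀ b₀ x y :* (ε :* b₁) :+ E′ ε a₀ b₀ a₁ b₁ x y :* (ε :* b₂) :=
      E′ ε a₀ b₀ a₁ b₁ (ε :* a₂) (ε :* b₂) :* y) Eq.refl ε x y a₀ b₀ a₁ b₁ a₂ b₂)
    where
    α₀ α₁ α₂ d : Carrier
    α₀ = value (side t 0F) p
    α₁ = value (side t 1F) p
    α₂ = value (side t 2F) p
    d  = value (side t 2F) (embed (t 2F))

    a₀ b₀ a₁ b₁ a₂ b₂ : Carrier
    a₀ = fromℤ (proj₁ (t 0F))
    b₀ = fromℤ (proj₂ (t 0F))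
    a₁ = fromℤ (proj₁ (t 1F))
    b₁ = fromℤ (proj₂ (t 1F))
    a₂ = fromℤ (proj₁ (t 2F))
    b₂ = fromℤ (proj₂ (t 2F))

    E : (a b a′ b′ x y : Carrier) → Carrier
    E a b a′ b′ x y = (b - b′) * x + (a′ - a) * y + ε * (a * b′ - a′ * b)

    E′ : ∀ {n} (ε a b a′ b′ x y : Polynomial n) → Polynomial n
    E′ ε a b a′ b′ x y = (b :- b′) :* x :+ (a′ :- a) :* y :+ ε :* (a :* b′ :- a′ :* b)

    0<d : 0# < d
    0<d = <-respʳ-≈ (Eq.sym (value-embed (side t 2F) (t 2F))) (*-positive 0<ε (fromℤ-positive 0<D))

    d⁻¹ : Carrier
    d⁻¹ = d ⁻¹⟨ 0<d ⟩

    d⁻¹*d≈1 : d⁻¹ * d ≈ 1#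
    d⁻¹*d≈1 = Eq.trans (*-comm d⁻¹ d) (⁻¹-inverse d 0<d)

    nonNegative : ∀ i → 0# ≤ d⁻¹ * value (side t i) p
    nonNegative i = *-nonNegative (⁻¹-nonNegative 0<d (⁻¹-inverse d 0<d)) (0≤sides i)

    coordinate : ∀ c₀ c₁ c₂ z →
      E a₁ b₁ a₂ b₂ x y * (ε * c₀) + E a₂ b₂ a₀ b₀ x y * (ε * c₁) + E a₀ b₀ a₁ b₁ x y * (ε * c₂) ≈
        E a₀ b₀ a₁ b₁ (ε * a₂) (ε * b₂) * z →
      z ≈ d⁻¹ * α₀ * (ε * c₀) + d⁻¹ * α₁ * (ε * c₁) + d⁻¹ * α₂ * (ε * c₂)
    coordinate c₀ c₁ c₂ z eq = Eq.sym (begin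
      d⁻¹ * α₀ * (ε * c₀) + d⁻¹ * α₁ * (ε * c₁) + d⁻¹ * α₂ * (ε * c₂)
        ≈⟨ solve 7 (λ d α β γ u v w → d :* α :* u :+ d :* β :* v :+ d :* γ :* w := d :* (α :* u :+ β :* v :+ γ :* w))
             Eq.refl d⁻¹ α₀ α₁ α₂ (ε * c₀) (ε * c₁) (ε * c₂) ⟩
      d⁻¹ * (α₀ * (ε * c₀) + α₁ * (ε * c₁) + α₂ * (ε * c₂))
        ≈⟨ *-congˡ (+-cong
             (+-cong (*-congʳ (value-through (t 1F) (t 2F) p)) (*-congʳ (value-through (t 2F) (t 0F) p)))
             (*-congʳ (value-through (t 0F) (t 1F) p))) ⟩
      d⁻¹ * (E a₁ b₁ a₂ b₂ x y * (ε * c₀) + E a₂ b₂ a₀ b₀ x y * (ε * c₁) + E a₀ b₀ a₁ b₁ x y * (ε * c₂))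
        ≈⟨ *-congˡ eq ⟩
      d⁻¹ * (E a₀ b₀ a₁ b₁ (ε * a₂) (ε * b₂) * z)
        ≈⟨ *-congˡ (*-congʳ (value-through (t 0F) (t 1F) (embed (t 2F)))) ⟨
      d⁻¹ * (d * z)
        ≈⟨ solve 3 (λ i d z → i :* (d :* z) := (i :* d) :* z) Eq.refl d⁻¹ d z ⟩
      d⁻¹ * d * z
        ≈⟨ *-congʳ d⁻¹*d≈1 ⟩
      1# * z
        ≈⟨ *-identityˡ z ⟩
      z ∎)



  value-translate : (L : Line) (x y a b : Carrier) → let (u , v , _) = L in
    value L (x + a , y + b) ≈ value L (x , y) + (fromℤ u * a + fromℤ v * b)
  value-translate (u , v , k) x y a b = solve 7 (λ u v k x y a b →
    u :* (x :+ a) :+ v :* (y :+ b) :+ k := (u :* x :+ v :* y :+ k) :+ (u :* a :+ v :* b))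
    Eq.refl (fromℤ u) (fromℤ v) (ε * fromℤ k) x y a b

  -- At a common interior point `L` is non-negative because of t, while it stays at most 0 after any
  -- small displacement inside t′. Hence ua + vb ≤ 0 for displacements (a, b) along both axes and of
  -- both signs, which forces u = v = 0.
  separates⇒disjoint : ∀ L t t′ → Separates L t t′ → ∀ {p} →
    p ∈ Interior (closed (embedTriangle t)) → ¬ p ∈ Interior (closed (embedTriangle t′))
  separates⇒disjoint L@(u , v , k) t t′ (0≤L , L≤0 , 0<u²+v²) {x , y} (r , 0<r , ball⊆t) (r′ , 0<r′ , ball⊆t′) =
    proj₂ (*-positive 0<δ (fromℤ-positive 0<u²+v²)) (Eq.sym (begin
      δ * fromℤ (u ℤ.* u ℤ.+ v ℤ.* v)
        ≈⟨ *-congˡ (Eq.trans (fromℤ-+ (u ℤ.* u) (v ℤ.* v)) (+-cong (fromℤ-* u u) (fromℤ-* v v))) ⟩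
      δ * (fromℤ u * fromℤ u + fromℤ v * fromℤ v)
        ≈⟨ solve 3 (λ δ u v → δ :* (u :* u :+ v :* v) := u :* (u :* δ) :+ v :* (v :* δ)) Eq.refl δ (fromℤ u) (fromℤ v) ⟩
      fromℤ u * (fromℤ u * δ) + fromℤ v * (fromℤ v * δ)
        ≈⟨ +-cong (*-congˡ uδ≈0) (*-congˡ vδ≈0) ⟩
      fromℤ u * 0# + fromℤ v * 0#
        ≈⟨ solve 2 (λ u v → u :* con 0ℤ :+ v :* con 0ℤ := con 0ℤ) Eq.refl (fromℤ u) (fromℤ v) ⟩
      0# ∎))
    where
    δ : Carrier
    -- Half the radius, since `Interior` asks for strict inequalities.
    δ = ½ * r′

    0<δ : 0# < δ
    0<δ = *-positive 0<½ 0<r′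

    δ+δ≈r′ : δ + δ ≈ r′
    δ+δ≈r′ = begin
      ½ * r′ + ½ * r′   ≈⟨ solve 2 (λ h r → h :* r :+ h :* r := con (+ 2) :* h :* r) Eq.refl ½ r′ ⟩
      2# * ½ * r′       ≈⟨ *-congʳ 2*½ ⟩
      1# * r′           ≈⟨ *-identityˡ r′ ⟩
      r′                ∎

    centred : ∀ {z} a → ∣ a ∣ ≤ δ → ∣ (z + a) - z ∣ < r′
    centred {z} a ∣a∣≤δ = ≰⇒> λ r′≤ → <⇒≱ 0<δ (≤-by
      (begin
        0# - δ           ≈⟨ solve 1 (λ δ → con 0ℤ :- δ := δ :- (δ :+ δ)) Eq.refl δ ⟩
        δ - (δ + δ)      ≈⟨ +-congˡ (-‿cong δ+δ≈r′) ⟩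
        δ - r′           ∎)
      (x≤y⇒0≤y-x (≤-trans r′≤ (≤-respˡ-≈ (∣∣-cong (solve 2 (λ z a → a := (z :+ a) :- z) Eq.refl z a)) ∣a∣≤δ))))

    p∈t : (x , y) ∈ closed (embedTriangle t)
    p∈t = ball⊆t x y (self x) (self y)
      where
      self : ∀ z → ∣ z - z ∣ < r
      self z = ≰⇒> λ r≤ → <⇒≱ 0<r (≤-trans r≤ (≤-reflexive (Eq.trans (∣∣-cong (-‿inverseʳ z)) (0≤x⇒∣x∣≈x ≤-refl))))

    increase≤0 : ∀ a b → ∣ a ∣ ≤ δ → ∣ b ∣ ≤ δ → fromℤ u * a + fromℤ v * b ≤ 0#
    increase≤0 a b ∣a∣≤δ ∣b∣≤δ = ≤-by
      (begin
        0# - (fromℤ u * a + fromℤ v * b)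
          ≈⟨ solve 2 (λ w z → con 0ℤ :- z := w :+ (con 0ℤ :- (w :+ z))) Eq.refl (value L (x , y)) _ ⟩
        value L (x , y) + (0# - (value L (x , y) + (fromℤ u * a + fromℤ v * b)))
          ≈⟨ +-congˡ (+-congˡ (-‿cong (value-translate L x y a b))) ⟨
        value L (x , y) + (0# - value L (x + a , y + b)) ∎)
      (+-nonNegative (closed-value-0≤ t L 0≤L p∈t)
        (x≤y⇒0≤y-x (closed-value-≤0 t′ L L≤0 (ball⊆t′ (x + a) (y + b) (centred a ∣a∣≤δ) (centred b ∣b∣≤δ)))))

    ∣δ∣≤δ : ∣ δ ∣ ≤ δ
    ∣δ∣≤δ = ≤-reflexive (0≤x⇒∣x∣≈x (proj₁ 0<δ))

    ∣-δ∣≤δ : ∣ - δ ∣ ≤ δ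
    ∣-δ∣≤δ = ≤-respˡ-≈ (Eq.sym (∣-x∣≈∣x∣ δ)) ∣δ∣≤δ

    ∣0∣≤δ : ∣ 0# ∣ ≤ δ
    ∣0∣≤δ = ≤-respˡ-≈ (Eq.sym (0≤x⇒∣x∣≈x ≤-refl)) (proj₁ 0<δ)

    uδ≈0 : fromℤ u * δ ≈ 0#
    uδ≈0 = antisym
      (≤-respˡ-≈ (solve 3 (λ u v δ → u :* δ :+ v :* con 0ℤ := u :* δ) Eq.refl (fromℤ u) (fromℤ v) δ)
        (increase≤0 δ 0# ∣δ∣≤δ ∣0∣≤δ))
      (≤-by (solve 3 (λ u v δ → u :* δ :- con 0ℤ := con 0ℤ :- (u :* :- δ :+ v :* con 0ℤ)) Eq.refl (fromℤ u) (fromℤ v) δ)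
        (x≤y⇒0≤y-x (increase≤0 (- δ) 0# ∣-δ∣≤δ ∣0∣≤δ)))

    vδ≈0 : fromℤ v * δ ≈ 0#
    vδ≈0 = antisym
      (≤-respˡ-≈ (solve 3 (λ u v δ → u :* con 0ℤ :+ v :* δ := v :* δ) Eq.refl (fromℤ u) (fromℤ v) δ)
        (increase≤0 0# δ ∣0∣≤δ ∣δ∣≤δ))
      (≤-by (solve 3 (λ u v δ → v :* δ :- con 0ℤ := con 0ℤ :- (u :* con 0ℤ :+ v :* :- δ)) Eq.refl (fromℤ u) (fromℤ v) δ)
        (x≤y⇒0≤y-x (increase≤0 0# (- δ) ∣0∣≤δ ∣-δ∣≤δ)))

  private
    left : ∀ x y → x ≈ value (+ 1 , + 0 , + 0) (x , y)
    left x y = solve 3 (λ ε x y → x := con 1ℤ :* x :+ con 0ℤ :* y :+ ε :* con 0ℤ) Eq.refl ε x y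

    bottom : ∀ x y → y ≈ value (+ 0 , + 1 , + 0) (x , y)
    bottom x y = solve 3 (λ ε x y → y := con 0ℤ :* x :+ con 1ℤ :* y :+ ε :* con 0ℤ) Eq.refl ε x y

    1≈εN : 1# ≈ ε * fromℕ N
    1≈εN = Eq.trans (Eq.sym N*ε≈1) (*-comm (fromℕ N) ε)

    right : ∀ x y → 1# - x ≈ value (ℤ.- + 1 , + 0 , + N) (x , y)
    right x y = Eq.trans (+-congʳ 1≈εN)
      (solve 4 (λ ε N x y → ε :* N :- x := :- con 1ℤ :* x :+ con 0ℤ :* y :+ ε :* N) Eq.refl ε (fromℕ N) x y)

    top : ∀ x y → 1# - y ≈ value (+ 0 , ℤ.- + 1 , + N) (x , y)
    top x y = Eq.trans (+-congʳ 1≈εN)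
      (solve 4 (λ ε N x y → ε :* N :- y := con 0ℤ :* x :+ :- con 1ℤ :* y :+ ε :* N) Eq.refl ε (fromℕ N) x y)

  UnitSquare⇒squareSides : ∀ {p} → p ∈ UnitSquare → All (λ L → 0# ≤ value L p) (squareSides N)
  UnitSquare⇒squareSides {x , y} ((0≤x , x≤1) , (0≤y , y≤1)) =
    ≤-respʳ-≈ (left x y) 0≤x ∷ ≤-respʳ-≈ (right x y) (x≤y⇒0≤y-x x≤1) ∷
    ≤-respʳ-≈ (bottom x y) 0≤y ∷ ≤-respʳ-≈ (top x y) (x≤y⇒0≤y-x y≤1) ∷ []

  squareSides⇒UnitSquare : ∀ {p} → All (λ L → 0# ≤ value L p) (squareSides N) → p ∈ UnitSquare
  squareSides⇒UnitSquare {x , y} (l ∷ r ∷ b ∷ t ∷ []) =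
    (≤-respʳ-≈ (Eq.sym (left x y)) l , ≤-by (right x y) r) ,
    (≤-respʳ-≈ (Eq.sym (bottom x y)) b , ≤-by (top x y) t)

  -- Totality of the order decides at each cut which branch the point follows; a point on the cut
  -- may go either way.
  locate : ∀ {n} (ts : Vector GridTriangle n) → (∀ i → 0ℤ ℤ.< doubleArea (ts i)) → ∀ Γ partition → Covers ts Γ partition →
    ∀ {p} → All (λ L → 0# ≤ value L p) Γ → ∃[ i ] p ∈ closed (embedTriangle (ts i))
  locate ts 0<areas Γ (cell i) implied 0≤Γ = i , sides-0≤⇒∈closed (ts i) (0<areas i) λ j →
    let 0≤L , L⇒side = All.lookupAny 0≤Γ (implied j) in implies-sound (Any.lookup (implied j)) (side (ts i) j) L⇒side 0≤L
  locate ts 0<areas Γ (cut L l r) (coversˡ , coversʳ) {p} 0≤Γ =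
    [ (λ 0≤L → locate ts 0<areas (L ∷ Γ) l coversˡ (0≤L ∷ 0≤Γ))
    , (λ L≤0 → locate ts 0<areas (opposite L ∷ Γ) r coversʳ
        (≤-respʳ-≈ (Eq.trans (+-identityˡ _) (Eq.sym (value-opposite L p))) (x≤y⇒0≤y-x L≤0) ∷ 0≤Γ))
    ]′ (total 0# (value L p))

  module _ {n lo hi} {ts : Vector GridTriangle n} {partition : Partition n}
    (isGridDissection : IsGridDissection N lo hi ts partition) where
    open IsGridDissection isGridDissection using (0<lo; doubleAreas; inSquare; separated; covers)

    private
      0<doubleAreas : ∀ i → 0ℤ ℤ.< doubleArea (ts i)
      0<doubleAreas i = ℤ.<-≤-trans (ℤ.+<+ 0<lo) (proj₁ (doubleAreas i))

      area≈ : ∀ i → area (embedTriangle (ts i)) ≈ ½ * (ε * (ε * fromℤ (doubleArea (ts i))))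
      area≈ i = *-congˡ (Eq.trans (∣∣-cong (det-embed (ts i))) (0≤x⇒∣x∣≈x
        (*-nonNegative (proj₁ 0<ε) (*-nonNegative (proj₁ 0<ε) (fromℤ-mono-≤ (ℤ.<⇒≤ (0<doubleAreas i)))))))

      scale-mono-≤ : ∀ {x y} → x ≤ y → ½ * (ε * (ε * x)) ≤ ½ * (ε * (ε * y))
      scale-mono-≤ x≤y = *-monoʳ-≤ (proj₁ 0<½) (*-monoʳ-≤ (proj₁ 0<ε) (*-monoʳ-≤ (proj₁ 0<ε) x≤y))

    dissection : Dissection n
    dissection = record
      { triangles     = λ i → embedTriangle (ts i)
      ; nondegenerate = λ i → <-respʳ-≈ (Eq.sym (area≈ i))
          (*-positive 0<½ (*-positive 0<ε (*-positive 0<ε (fromℤ-positive (0<doubleAreas i)))))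
      ; disjoint      = disjoint
      ; covers        =
          (λ (i , p∈tᵢ) → squareSides⇒UnitSquare (All.map (λ {L} 0≤L → closed-value-0≤ (ts i) L 0≤L p∈tᵢ) (inSquare i))) ,
          (λ p∈square → locate ts 0<doubleAreas (squareSides N) partition covers (UnitSquare⇒squareSides p∈square))
      }
      where
      disjoint : ∀ {i j} → i ≢ j →
        Interior (closed (embedTriangle (ts i))) ⊥ Interior (closed (embedTriangle (ts j)))
      disjoint {i} {j} i≢j (p∈tᵢ , p∈tⱼ) =
        [ (λ i≡j → i≢j i≡j)
        , [ (λ (k , sep) → separates⇒disjoint (side (ts i) k) (ts i) (ts j) sep p∈tᵢ p∈tⱼ)
          , (λ (k , sep) → separates⇒disjoint (side (ts j) k) (ts j) (ts i) sep p∈tⱼ p∈tᵢ)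
          ]′
        ]′ (separated i j)

    areas-≥ : ∀ i → ½ * (ε * (ε * fromℕ lo)) ≤ areas dissection i
    areas-≥ i = ≤-respʳ-≈ (Eq.sym (area≈ i)) (scale-mono-≤ (fromℤ-mono-≤ (proj₁ (doubleAreas i))))

    areas-≤ : ∀ i → areas dissection i ≤ ½ * (ε * (ε * fromℕ hi))
    areas-≤ i = ≤-respˡ-≈ (Eq.sym (area≈ i)) (scale-mono-≤ (fromℤ-mono-≤ (proj₂ (doubleAreas i))))

  areaRange-upper-bound : ∀ {n lo hi} {ts : Vector GridTriangle (suc n)} {partition : Partition (suc n)}
    (isGridDissection : IsGridDissection N lo hi ts partition) →
    ∀ K δ → K ℕ.* hi ℕ.≤ K ℕ.* lo ℕ.+ 2 ℕ.* δ ℕ.* (N ℕ.* N) →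
    fromℕ K * areaRange (dissection isGridDissection) ≤ fromℕ δ
  areaRange-upper-bound {lo = lo} {hi = hi} d K δ Khi≤Klo+2δN² = ≤-trans
    (*-monoʳ-≤ (fromℕ-nonNegative K) (+-mono-≤
      (maximum-lub (areas D) (areas-≤ d)) (-‿antimono-≤ (minimum-glb (areas D) (areas-≥ d)))))
    (≤-by
      (begin
        fromℕ δ - fromℕ K * (½ * (ε * (ε * fromℕ hi)) - ½ * (ε * (ε * fromℕ lo)))
          -- Multiplying δ by 1 = 2 · ½ · (Nε)² brings both terms to the common factor ½ ε².
          ≈⟨ +-congʳ (Eq.trans (Eq.sym (*-identityˡ (fromℕ δ))) (*-congʳ (Eq.sym unit))) ⟩
        (2# * ½ * (fromℕ N * ε * (fromℕ N * ε))) * fromℕ δ - fromℕ K * (½ * (ε * (ε * fromℕ hi)) - ½ * (ε * (ε * fromℕ lo)))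
          ≈⟨ solve 7 (λ h ε N K δ hi lo →
               (con (+ 2) :* h :* (N :* ε :* (N :* ε))) :* δ :- K :* (h :* (ε :* (ε :* hi)) :- h :* (ε :* (ε :* lo))) :=
               h :* (ε :* (ε :* ((K :* lo :+ con (+ 2) :* δ :* (N :* N)) :- K :* hi))))
               Eq.refl ½ ε (fromℕ N) (fromℕ K) (fromℕ δ) (fromℕ hi) (fromℕ lo) ⟩
        ½ * (ε * (ε * ((fromℕ K * fromℕ lo + 2# * fromℕ δ * (fromℕ N * fromℕ N)) - fromℕ K * fromℕ hi))) ∎)
      (*-nonNegative (proj₁ 0<½) (*-nonNegative (proj₁ 0<ε) (*-nonNegative (proj₁ 0<ε)
        (x≤y⇒0≤y-x (≤-respˡ-≈ (fromℕ-* K hi) (≤-respʳ-≈ homo (fromℕ-mono-≤ Khi≤Klo+2δN²))))))))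
    where
    D = dissection d

    unit : 2# * ½ * (fromℕ N * ε * (fromℕ N * ε)) ≈ 1#
    unit = Eq.trans (*-cong 2*½ (*-cong N*ε≈1 N*ε≈1)) (Eq.trans (*-identityˡ _) (*-identityˡ _))

    homo : fromℕ (K ℕ.* lo ℕ.+ 2 ℕ.* δ ℕ.* (N ℕ.* N)) ≈ fromℕ K * fromℕ lo + 2# * fromℕ δ * (fromℕ N * fromℕ N)
    homo = Eq.trans (fromℕ-+ (K ℕ.* lo) _) (+-cong (fromℕ-* K lo)
      (Eq.trans (fromℕ-* (2 ℕ.* δ) _) (*-cong (fromℕ-* 2 δ) (fromℕ-* N N))))

-- The points a, b, c, e make the first four areas exactly 1/9; f and g round
-- the points that would do the same for the next two, in order to keep the
-- common denominator small.
module Competitor where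

  side-length minDoubleArea maxDoubleArea : ℕ
  -- This is 2 · 3^5 · 7 · 29 · 31, the least common denominator: `m` halves `p a`, `f` lies at
  -- 10/27 of `p b`, `c` brings in 7, `g` lies at 17/29 of `a e`, and `e` brings in 31.
  side-length   = 3058398
  -- Attained by the triangle `e b f`, as the maximum is by `p g f`; the mean is 2078621850312.
  minDoubleArea = 2077734914892
  maxDoubleArea = 2079200907000

  p q s t a b c e f g m : GridPoint
  p = + 0 , + 0
  q = + 3058398 , + 0
  s = + 0 , + 3058398
  t = + 3058398 , + 3058398
  a = + 3058398 , + 679644
  b = + 679644 , + 3058398
  c = + 3058398 , + 2184570
  e = + 1677186 , + 2691954
  f = + 251720 , + 1132740
  g = + 2248722 , + 1859274
  m = + 1529199 , + 339822

  gridTriangles : Vector GridTriangle 9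
  gridTriangles 0F = corners p q a
  gridTriangles 1F = corners p b s
  gridTriangles 2F = corners b c t
  gridTriangles 3F = corners a c e
  gridTriangles 4F = corners e b f
  gridTriangles 5F = corners f g e
  gridTriangles 6F = corners p g f
  gridTriangles 7F = corners p m g
  gridTriangles 8F = corners m a g

  -- Each cut peels one triangle off the remaining polygon. The other sides lie on earlier cuts or
  -- on the square, because `e` is on `b c`, `f` on `p b`, `g` on `a e` and `m` on `p a`.
  partition : Partition 9
  partition =
    cut (through a p) (cell 0F) (
    cut (through p b) (cell 1F) (
    cut (through b c) (cell 2F) (
    cut (through e a) (cell 3F) (
    cut (through f e) (cell 4F) (
    cut (through f g) (cell 5F) (
    cut (through p g) (cell 6F) (
    cut (through m g) (cell 7F) (cell 8F))))))))

  abstract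
    gridDissection : IsGridDissection side-length minDoubleArea maxDoubleArea gridTriangles partition
    gridDissection = toWitness {a? = isGridDissection? side-length minDoubleArea maxDoubleArea gridTriangles partition} _

abstract
  -- The scale 90000 makes the mean area exactly 10000 and also fixes the unit to which the boxes
  -- are rounded.
  intervals-refutable : IntervalSearch.Refutable 90000 9992 10008 8 (box 0 0 0 0)
  intervals-refutable = toWitness {a? = IntervalSearch.refutable? 90000 9992 10008 8 (box 0 0 0 0)} _

corollary4 : ∀ {c ℓ₁ ℓ₂} (ℝ : CompleteOrderedField c ℓ₁ ℓ₂) → let open Geometry ℝ in
    (D : Dissection 9) → RangeMinimizing D → ¬ InSingleCapTwoRailFamily D
corollary4 ℝ D (areaRange-≤ , _) (σ , κ , (0<κ , κ<½) , s , Z , π , same) =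
  areaRange-lower-bound 0<κ κ<½ Z minimum≤family family≤maximum
    -- The competitor's range times 90000 is about 7.05, rounded up to 8. Both numerical conditions
    -- are equalities: 9 · (9992 + 8) = 90000 and 90000 + 9 · 8 = 9 · 10008.
    {90000} {9992} {10008} {8} (ℕ.s≤s ℕ.z≤n) (ℕ.≤ᵇ⇒≤ _ _ _) (ℕ.≤ᵇ⇒≤ _ _ _) intervals-refutable
    (≤-trans (*-monoʳ-≤ (fromℕ-nonNegative 90000) (areaRange-≤ _ (D* , Eq.refl)))
      (areaRange-upper-bound Competitor.gridDissection 90000 8 (ℕ.≤ᵇ⇒≤ _ _ _)))
  where
  open OrderedField ℝ
  open Geometry ℝ
  open Area ℝ
  open Family ℝ
  open Extrema ℝ
  open Grid ℝ (IsGridDissection.0<N Competitor.gridDissection)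

  D* : Dissection 9
  D* = dissection Competitor.gridDissection

  -- The bounds are wanted for every member of the family, so the matching is read backwards through
  -- the inverse permutation.
  family : ∀ j → area (singleCapTwoRail κ Z j) ≈ areas D (π ⟨$⟩ˡ j)
  family j = ≡.subst (λ i → area (singleCapTwoRail κ Z i) ≈ areas D (π ⟨$⟩ˡ j)) (inverseʳ π)
    (Eq.trans (Eq.sym (area-applyTriangle σ (singleCapTwoRail κ Z (π ⟨$⟩ʳ (π ⟨$⟩ˡ j)))))
      (antisym (area-mono-⊆ (proj₂ (same (π ⟨$⟩ˡ j)))) (area-mono-⊆ (proj₁ (same (π ⟨$⟩ˡ j))))))

  minimum≤family : ∀ j → minimum (areas D) ≤ area (singleCapTwoRail κ Z j)
  minimum≤family j = ≤-respʳ-≈ (Eq.sym (family j)) (minimum≤xs (areas D) (π ⟨$⟩ˡ j))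

  family≤maximum : ∀ j → area (singleCapTwoRail κ Z j) ≤ maximum (areas D)
  family≤maximum j = ≤-respˡ-≈ (Eq.sym (family j)) (xs≤maximum (areas D) (π ⟨$⟩ˡ j))
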